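{- Let $G=(P,B)$ be an irreducible braced triangulation with $b=|B|\geq 1$ braces. Then $|V(P)|\leq 11b-4$.
   Context: A sphere graph is a simple graph with a fixed embedding in the 2-sphere without edge crossings. A (sphere) triangulation $P$ is a maximal sphere graph with at least 3 vertices. An edge $e$ of $P$ is contractible in $P$ if it belongs to precisely two 3-cycles of $P$. A braced triangulation $G=(P,B)$ is the simple graph obtained from a triangulation $P$ by adjoining a set $B$ of additional edges (braces) joining pairs of vertices of $P$ that are not adjacent in $P$. An edge $e$ of $P$ is contractible in $G$ if $e$ is contractible in $P$ and $e$ does not belong to any 3-cycle of $G$ that contains a brace. $G$ is irreducible if no edge of $P$ is contractible in $G$. -}

module Defs where

open import Data.Nat using (ℕ; zero; suc; _+_; _*_; _≤_; _<_)
open import Data.Fin using (Fin; toℕ)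
open import Data.Product using (Σ; ∃; ∃-syntax; _×_; _,_)
open import Data.Sum using (_⊎_)
open import Data.List using (List)
open import Data.List.Membership.Propositional using (_∈_)
open import Data.List.Relation.Unary.All using (All)
open import Data.List.Relation.Unary.Unique.Propositional using (Unique)
open import Relation.Nullary using (¬_)
open import Relation.Binary.PropositionalEquality using (_≡_; _≢_)

iter : ∀ {A : Set} → (A → A) → ℕ → A → A
iter f zero    x = x
iter f (suc k) x = f (iter f k x)

data Reach {d : ℕ} (σ α : Fin d → Fin d) (x : Fin d) : Fin d → Set where
  here  : Reach σ α x x
  stepσ : ∀ {y} → Reach σ α x y → Reach σ α x (σ y)
  stepα : ∀ {y} → Reach σ α x y → Reach σ α x (α y)

-- A sphere triangulation on the vertex set Fin n, given as a combinatorial map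
-- (rotation system): darts Fin d, fixed-point-free involution α (the two darts
-- of an edge), permutation σ (rotation around a vertex), faces = orbits of
-- φ = σ ∘ α.  The embedding is in the sphere iff the map is connected and
-- V - E + F = 2.  All faces are triangles: φ³ = id with no fixed points, so
-- F = d/3, E = d/2, V = n, and Euler's formula reads d + 12 = 6n.
record SphereTriangulation (n : ℕ) : Set where
  field
    d       : ℕ
    α       : Fin d → Fin d
    σ       : Fin d → Fin d
    σ⁻¹     : Fin d → Fin d
    σ-left  : ∀ x → σ⁻¹ (σ x) ≡ x
    σ-right : ∀ x → σ (σ⁻¹ x) ≡ x
    α-invol : ∀ x → α (α x) ≡ x
    α-fpf   : ∀ x → α x ≢ x
    face-3    : ∀ x → σ (α (σ (α (σ (α x))))) ≡ x
    face-fpf  : ∀ x → σ (α x) ≢ x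
    -- vertices = σ-orbits, identified with Fin n via tail
    tail        : Fin d → Fin n
    tail-σ      : ∀ x → tail (σ x) ≡ tail x
    tail-surj   : ∀ u → ∃[ x ] tail x ≡ u
    tail-orbit  : ∀ x y → tail x ≡ tail y → ∃[ k ] iter σ k x ≡ y
    no-loop     : ∀ x → tail (α x) ≢ tail x
    no-multi    : ∀ x y → tail x ≡ tail y → tail (α x) ≡ tail (α y) → x ≡ y
    connected   : ∀ x y → Reach σ α x y
    euler       : d + 12 ≡ 6 * n
    three≤n     : 3 ≤ n

module _ {n : ℕ} (P : SphereTriangulation n) where
  open SphereTriangulation P

  Adj : Fin n → Fin n → Set
  Adj u w = ∃[ x ] (tail x ≡ u × tail (α x) ≡ w)

  -- the edge uw of P lies in precisely two 3-cycles of P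
  -- (3-cycles through uw correspond to common neighbours z of u and w)
  ContractibleInP : Fin n → Fin n → Set
  ContractibleInP u w =
    Adj u w ×
    (Σ (Fin n) λ z₁ → Σ (Fin n) λ z₂ →
       z₁ ≢ z₂ × (Adj u z₁ × Adj w z₁) × (Adj u z₂ × Adj w z₂) ×
       (∀ z → Adj u z → Adj w z → z ≡ z₁ ⊎ z ≡ z₂))

  -- a valid set of braces: pairs (u , w) with toℕ u < toℕ w (an unordered
  -- pair listed once), no repetitions, joining vertices non-adjacent in P
  ValidBraces : List (Fin n × Fin n) → Set
  ValidBraces B =
    All (λ p → toℕ (Data.Product.proj₁ p) < toℕ (Data.Product.proj₂ p)
               × ¬ Adj (Data.Product.proj₁ p) (Data.Product.proj₂ p)) B
    × Unique B

  module _ (B : List (Fin n × Fin n)) where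
    Brace : Fin n → Fin n → Set
    Brace u w = (u , w) ∈ B ⊎ (w , u) ∈ B

    AdjG : Fin n → Fin n → Set
    AdjG u w = Adj u w ⊎ Brace u w

    -- e = uw contractible in G: contractible in P and no 3-cycle of G
    -- through e contains a brace (e itself is an edge of P, not a brace)
    ContractibleInG : Fin n → Fin n → Set
    ContractibleInG u w =
      ContractibleInP u w ×
      (∀ z → AdjG u z → AdjG w z → ¬ (Brace u z ⊎ Brace w z))

    Irreducible : Set
    Irreducible = ∀ u w → Adj u w → ¬ ContractibleInG u w

{-# OPTIONS --safe #-}

-- Let X be the set of ends of braces, so |X| ≤ 2b.  In the link cycle of a
-- vertex v chords do not cross, so an innermost chord leaves a link vertex w
-- without chords, and then vw is contractible in P.  If v ∉ X, irreducibility
-- yields a brace wz with z adjacent to v: every vertex outside X is adjacent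
-- to both ends of a brace.  If these are its only neighbours in X, then some
-- chord of its link gives a 3-cycle separating them, and all their common
-- neighbours lie on this 3-cycle; so each brace accounts for at most three
-- such vertices.  All other vertices outside X have at least three
-- neighbours in X.  As each triangle has at most one dart leading into X
-- from outside, there are at most d/3 = 2n - 4 such darts.  Altogether
-- 3n ≤ (2n - 4) + 3|X| + 3b, hence even n ≤ 9b - 4.
--
-- The only topological input is that 3-cycles separate.  It follows from
-- Euler's formula by linear algebra over 𝔽₂: face boundaries are orthogonal
-- to vertex cuts and the two spaces have complementary dimensions, so every
-- cycle is a sum of face boundaries.

module Submission where

open import Defs
open import Algebra.Bundles using (CommutativeMonoid; CommutativeRing; Semiring)
open import Data.Bool using (Bool; true; false; _∧_; _xor_; if_then_else_; not)
open import Data.Bool.Properties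
  using (xor-∧-commutativeRing; xor-same; xor-comm; xor-assoc; xor-identityʳ; ∧-zeroʳ; ∧-assoc;
         ∧-distribˡ-xor; ∧-distribʳ-xor; not-¬; not-involutive)
open import Data.Empty using (⊥-elim)
open import Data.Fin using (Fin; zero; suc; toℕ; fromℕ<)
open import Data.Fin.Permutation using (permutation)
open import Data.Fin.Properties using (_≟_; any?; suc-injective; toℕ-fromℕ<; toℕ<n)
open import Data.List using (List; length; lookup)
import Data.List.Membership.DecPropositional as DecMembership
open import Data.List.Membership.Propositional.Properties using (∈-lookup)
import Data.List.Relation.Unary.All as All
open import Data.List.Relation.Unary.Any using (index)
open import Data.List.Relation.Unary.Any.Properties using (lookup-index)
open import Data.Nat using (ℕ; zero; suc; pred; _+_; _*_; _∸_; _≤_; _<_; s≤s; z≤n)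
  renaming (NonZero to NonZeroℕ)
open import Data.Nat.DivMod using (_%_; _/_; m%n<n; m≡m%n+[m/n]*n)
import Data.Nat.Properties as ℕₚ
open import Data.Nat.Tactic.RingSolver using (solve-∀)
open import Data.Product using (Σ; ∃; ∃-syntax; _×_; _,_; proj₁; proj₂)
open import Data.Product.Properties using (≡-dec)
open import Data.Sum using (_⊎_; inj₁; inj₂; [_,_]′)
open import Data.Vec using (Vec; []; _∷_; zipWith; replicate) renaming (lookup to lookupᵛ)
open import Data.Vec.Properties using (lookup-zipWith)
open import Function using (_∘_; mk⇔)
open import Relation.Binary using (Decidable; IsEquivalence; tri<; tri≈; tri>)
open import Relation.Nullary using (Dec; yes; no; does; ¬_; ¬?; contradiction)
open import Relation.Nullary.Decidable using (does-⇔; dec-true; dec-false; _×-dec_; _⊎-dec_)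
import Relation.Unary as U
open import Relation.Binary.PropositionalEquality

-- Sums over fibres

module FibreSums {c ℓ} (M : CommutativeMonoid c ℓ) where
  open CommutativeMonoid M using (Carrier; _≈_; _∙_; ε; identityˡ; identityʳ; ∙-congˡ)
    renaming (refl to ≈-refl; trans to ≈-trans; sym to ≈-sym)
  open import Algebra.Properties.CommutativeMonoid.Sum M

  _when_ : Carrier → Bool → Carrier
  a when b = if b then a else ε

  sum-zero : ∀ {n} (f : Fin n → Carrier) → (∀ i → f i ≈ ε) → sum f ≈ ε
  sum-zero {n} f f≈ε = ≈-trans (sum-cong-≋ f≈ε) (sum-replicate-zero n)

  sum-pick : ∀ {n} (f : Fin n → Carrier) j → sum (λ i → f i when does (i ≟ j)) ≈ f j
  sum-pick {suc n} f zero    = ≈-trans (∙-congˡ (sum-replicate-zero n)) (identityʳ _)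
  sum-pick         f (suc j) = ≈-trans (identityˡ _) (sum-pick (f ∘ suc) j)

  sum-pick′ : ∀ {n} (f : Fin n → Carrier) j → sum (λ i → f i when does (j ≟ i)) ≈ f j
  sum-pick′ {suc n} f zero    = ≈-trans (∙-congˡ (sum-replicate-zero n)) (identityʳ _)
  sum-pick′         f (suc j) = ≈-trans (identityˡ _) (sum-pick′ (f ∘ suc) j)

  sum-fibres : ∀ {m n} (p : Fin m → Fin n) (f : Fin m → Carrier) →
               sum f ≈ sum (λ j → sum (λ i → f i when does (p i ≟ j)))
  sum-fibres p f = ≈-trans
    (sum-cong-≋ (λ i → ≈-sym (sum-pick′ (λ _ → f i) (p i))))
    (∑-comm (λ i j → f i when does (p i ≟ j)))

open import Algebra.Properties.Semiring.Sum ℕₚ.+-*-semiring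
module +ᶠ = FibreSums (Semiring.+-commutativeMonoid ℕₚ.+-*-semiring)

import Algebra.Properties.Semiring.Sum (CommutativeRing.semiring xor-∧-commutativeRing) as ⊕
module ⊕ᶠ = FibreSums (CommutativeRing.+-commutativeMonoid xor-∧-commutativeRing)

sum-mono-≤ : ∀ {n} {f g : Fin n → ℕ} → (∀ i → f i ≤ g i) → sum f ≤ sum g
sum-mono-≤ {zero}  f≤g = z≤n
sum-mono-≤ {suc n} f≤g = ℕₚ.+-mono-≤ (f≤g zero) (sum-mono-≤ (f≤g ∘ suc))

sum-const : ∀ n c → sum {n} (λ _ → c) ≡ n * c
sum-const zero    c = refl
sum-const (suc n) c = cong (c +_) (sum-const n c)

-- Linear algebra over 𝔽₂

private variable
  p q : ℕ

_⊞_ : Vec Bool p → Vec Bool p → Vec Bool p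
_⊞_ = zipWith _xor_

𝟘 : Vec Bool p
𝟘 = replicate _ false

NonZero : Vec Bool p → Set
NonZero u = ∃[ i ] lookupᵛ u i ≡ true

record Additive (f : Vec Bool p → Bool) : Set where
  constructor additive
  field ⊞-homo : ∀ u v → f (u ⊞ v) ≡ f u xor f v

open Additive public

-- For an additive map, carrying nonzero vectors to nonzero vectors is injectivity, so kernel
-- vectors found in a subspace stay nonzero in the whole space.
record Embedding (p q : ℕ) : Set where
  field
    to      : Vec Bool p → Vec Bool q
    to-⊞    : ∀ u v → to (u ⊞ v) ≡ to u ⊞ to v
    nonZero : ∀ u → NonZero u → NonZero (to u)

𝟘-⊞ : (u : Vec Bool p) → 𝟘 ⊞ u ≡ u
𝟘-⊞ []      = refl
𝟘-⊞ (b ∷ u) = cong (b ∷_) (𝟘-⊞ u)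

xor-cancelled : ∀ {a b} → a xor b ≡ false → a ≡ b
xor-cancelled {true}  {true}  _ = refl
xor-cancelled {false} {false} _ = refl

xor-interchange : ∀ a b c d → (a xor b) xor (c xor d) ≡ (a xor c) xor (b xor d)
xor-interchange a b c d = begin
  (a xor b) xor (c xor d) ≡⟨ xor-assoc a b (c xor d) ⟩
  a xor (b xor (c xor d)) ≡⟨ cong (a xor_) (xor-assoc b c d) ⟨
  a xor ((b xor c) xor d) ≡⟨ cong (λ z → a xor (z xor d)) (xor-comm b c) ⟩
  a xor ((c xor b) xor d) ≡⟨ cong (a xor_) (xor-assoc c b d) ⟩
  a xor (c xor (b xor d)) ≡⟨ xor-assoc a c (b xor d) ⟨
  (a xor c) xor (b xor d) ∎
  where open ≡-Reasoning

additive-𝟘 : {f : Vec Bool p → Bool} → Additive f → f 𝟘 ≡ false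
additive-𝟘 {f = f} f-⊞ = begin
  f 𝟘                 ≡⟨ xor-identityʳ (f 𝟘) ⟨
  f 𝟘 xor false       ≡⟨ cong (f 𝟘 xor_) (xor-same (f 𝟘)) ⟨
  f 𝟘 xor (f 𝟘 xor f 𝟘) ≡⟨ xor-assoc (f 𝟘) _ _ ⟨
  (f 𝟘 xor f 𝟘) xor f 𝟘 ≡⟨ cong (_xor f 𝟘) (⊞-homo f-⊞ 𝟘 𝟘) ⟨
  f (𝟘 ⊞ 𝟘) xor f 𝟘   ≡⟨ cong (λ z → f z xor f 𝟘) (𝟘-⊞ 𝟘) ⟩
  f 𝟘 xor f 𝟘         ≡⟨ xor-same (f 𝟘) ⟩
  false               ∎
  where open ≡-Reasoning

additive-tail : {f : Vec Bool (suc p) → Bool} → Additive f → Additive (f ∘ (false ∷_))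
additive-tail f-⊞ = additive λ u v → ⊞-homo f-⊞ (false ∷ u) (false ∷ v)

additive-∷ : {f : Vec Bool (suc p) → Bool} → Additive f →
             ∀ b u → f (b ∷ u) ≡ f (b ∷ 𝟘) xor f (false ∷ u)
additive-∷ {f = f} f-⊞ b u = trans
  (cong₂ (λ c v → f (c ∷ v)) (sym (xor-identityʳ b)) (sym (𝟘-⊞ u)))
  (⊞-homo f-⊞ (b ∷ 𝟘) (false ∷ u))

-- An additive functional is determined by its values on the standard basis, which are tested one at
-- a time.
vanishes? : (f : Vec Bool p → Bool) → Additive f → (∀ u → f u ≡ false) ⊎ ∃[ u ] f u ≡ true
vanishes? {zero}  f f-⊞ = inj₁ λ { [] → additive-𝟘 f-⊞ }
vanishes? {suc p} f f-⊞
  with f (true ∷ 𝟘) in eq | vanishes? (f ∘ (false ∷_)) (additive-tail f-⊞)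
... | true  | _             = inj₂ (true ∷ 𝟘 , eq)
... | false | inj₂ (u , fu) = inj₂ (false ∷ u , fu)
... | false | inj₁ f≡0      = inj₁ λ where
  (false ∷ u) → f≡0 u
  (true ∷ u)  → trans (additive-∷ f-⊞ true u) (cong₂ _xor_ eq (f≡0 u))

-- If `f` is true on the first basis vector, its kernel is the graph of `g` over the other
-- coordinates. If not, the first coordinate stays free and the search moves on to the tail.
hyperplane : (f : Vec Bool (suc p) → Bool) → Additive f →
             Σ (Embedding p (suc p)) λ ι → ∀ u → f (Embedding.to ι u) ≡ false
hyperplane {p} f f-⊞ with f (true ∷ 𝟘) in eq
... | true = ι , vanish
  where
  g : Vec Bool p → Bool
  g = f ∘ (false ∷_)

  ι : Embedding p (suc p)
  ι = record
    { to      = λ u → g u ∷ u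
    ; to-⊞    = λ u v → cong (_∷ _) (⊞-homo (additive-tail f-⊞) u v)
    ; nonZero = λ { u (i , ui) → suc i , ui }
    }

  vanish : ∀ u → f (g u ∷ u) ≡ false
  vanish u with g u in gu
  ... | true  = trans (additive-∷ f-⊞ true u) (cong₂ _xor_ eq gu)
  ... | false = gu
hyperplane {zero} f f-⊞ | false =
  record { to = λ _ → 𝟘 ; to-⊞ = λ _ _ → refl ; nonZero = λ { _ (() , _) } } , λ _ → additive-𝟘 f-⊞
hyperplane {suc p} f f-⊞ | false =
  record
    { to      = λ { (b ∷ u) → b ∷ ι.to u }
    ; to-⊞    = λ { (b ∷ u) (c ∷ v) → cong ((b xor c) ∷_) (ι.to-⊞ u v) }
    ; nonZero = λ where
        (b ∷ u) (zero , b≡1)   → zero , b≡1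
        (b ∷ u) (suc i , ui≡1) → let j , e = ι.nonZero u (i , ui≡1) in suc j , e
    } ,
  λ where
    (false ∷ u) → ι-vanish u
    (true ∷ u)  → trans (additive-∷ f-⊞ true (ι.to u)) (cong₂ _xor_ eq (ι-vanish u))
  where
  rec = hyperplane (f ∘ (false ∷_)) (additive-tail f-⊞)
  module ι = Embedding (proj₁ rec)
  ι-vanish = proj₂ rec

∘-additive : (ι : Embedding p q) {f : Vec Bool q → Bool} → Additive f → Additive (f ∘ Embedding.to ι)
∘-additive ι {f} f-⊞ = additive λ u v → trans (cong f (Embedding.to-⊞ ι u v)) (⊞-homo f-⊞ _ _)

Kernel : ∀ {E} → (Fin E → Vec Bool p → Bool) → Set
Kernel φ = ∃[ u ] NonZero u × (∀ e → φ e u ≡ false)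

-- Two orthogonal subspaces of 𝔽₂ᴱ have dimensions adding up to at most E.
orthogonal-kernel : ∀ E p q → E < p + q →
  (φ : Fin E → Vec Bool p → Bool) (ψ : Fin E → Vec Bool q → Bool) →
  (∀ e → Additive (φ e)) → (∀ e → Additive (ψ e)) →
  (∀ u v → ⊕.sum (λ e → φ e u ∧ ψ e v) ≡ false) →
  Kernel φ ⊎ Kernel ψ
orthogonal-kernel zero (suc p) q       _   φ ψ _   _   _ = inj₁ (true ∷ 𝟘 , (zero , refl) , λ ())
orthogonal-kernel zero zero    (suc q) _   φ ψ _   _   _ = inj₂ (true ∷ 𝟘 , (zero , refl) , λ ())
-- The induction on `E` strips coordinate zero. If `φ zero` does not vanish, `φ` is restricted to
-- its hyperplane; if it does, `ψ` is restricted instead, unless `q` is already zero.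
orthogonal-kernel (suc E) p q E<p+q φ ψ φ-⊞ ψ-⊞ φ⊥ψ with vanishes? (φ zero) (φ-⊞ zero)
orthogonal-kernel (suc E) zero q E<q φ ψ φ-⊞ ψ-⊞ φ⊥ψ | inj₂ ([] , φ₀) with () ←
  trans (sym φ₀) (additive-𝟘 (φ-⊞ zero))
orthogonal-kernel (suc E) (suc p) q (s≤s E<p+q) φ ψ φ-⊞ ψ-⊞ φ⊥ψ | inj₂ (w , φ₀w)
  with hyperplane (φ zero) (φ-⊞ zero)
... | ι , φ₀ι with orthogonal-kernel E p q E<p+q
    (λ e → φ (suc e) ∘ Embedding.to ι) (ψ ∘ suc)
    (λ e → ∘-additive ι (φ-⊞ (suc e))) (ψ-⊞ ∘ suc)
    (λ u v → trans
      (cong (λ b → (b ∧ ψ zero v) xor ⊕.sum (λ e → φ (suc e) (Embedding.to ι u) ∧ ψ (suc e) v)) (sym (φ₀ι u)))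
      (φ⊥ψ (Embedding.to ι u) v))
...   | inj₁ (u , u≢0 , φu) = inj₁ (Embedding.to ι u , Embedding.nonZero ι u u≢0 , λ where
          zero    → φ₀ι u
          (suc e) → φu e)
...   | inj₂ (v , v≢0 , ψv) = inj₂ (v , v≢0 , λ where
          zero    → ψ₀v
          (suc e) → ψv e)
  where
  -- In the pairing of `v` with `w` only the term at zero survives, and there `φ zero w` is true, so
  -- orthogonality forces `ψ zero v` to vanish.
  ψ₀v : ψ zero v ≡ false
  ψ₀v = begin
    ψ zero v                        ≡⟨ cong (_∧ ψ zero v) φ₀w ⟨
    φ zero w ∧ ψ zero v             ≡⟨ xor-identityʳ _ ⟨
    (φ zero w ∧ ψ zero v) xor false ≡⟨ cong ((φ zero w ∧ ψ zero v) xor_)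
        (⊕ᶠ.sum-zero _ (λ e → trans (cong (φ (suc e) w ∧_) (ψv e)) (∧-zeroʳ _))) ⟨
    ⊕.sum (λ e → φ e w ∧ ψ e v)     ≡⟨ φ⊥ψ w v ⟩
    false                           ∎
    where open ≡-Reasoning
orthogonal-kernel (suc E) p zero E<p φ ψ φ-⊞ ψ-⊞ φ⊥ψ | inj₁ φ₀
  with orthogonal-kernel E p zero (ℕₚ.≤-trans (ℕₚ.n≤1+n _) E<p) (φ ∘ suc) (ψ ∘ suc) (φ-⊞ ∘ suc) (ψ-⊞ ∘ suc)
    (λ u v → trans
      (cong (λ b → (b ∧ ψ zero v) xor ⊕.sum (λ e → φ (suc e) u ∧ ψ (suc e) v)) (sym (φ₀ u)))
      (φ⊥ψ u v))
... | inj₁ (u , u≢0 , φu) = inj₁ (u , u≢0 , λ { zero → φ₀ u ; (suc e) → φu e })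
... | inj₂ (_ , (() , _) , _)
orthogonal-kernel (suc E) p (suc q) E<p+q φ ψ φ-⊞ ψ-⊞ φ⊥ψ | inj₁ φ₀
  with hyperplane (ψ zero) (ψ-⊞ zero)
... | ι , ψ₀ι with orthogonal-kernel E p q (ℕₚ.≤-pred (ℕₚ.≤-trans E<p+q (ℕₚ.≤-reflexive (ℕₚ.+-suc p q))))
    (φ ∘ suc) (λ e → ψ (suc e) ∘ Embedding.to ι)
    (φ-⊞ ∘ suc) (λ e → ∘-additive ι (ψ-⊞ (suc e)))
    (λ u v → trans
      (cong (λ b → (b ∧ ψ zero (Embedding.to ι v)) xor ⊕.sum (λ e → φ (suc e) u ∧ ψ (suc e) (Embedding.to ι v)))
            (sym (φ₀ u)))
      (φ⊥ψ u (Embedding.to ι v)))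
...   | inj₁ (u , u≢0 , φu) = inj₁ (u , u≢0 , λ { zero → φ₀ u ; (suc e) → φu e })
...   | inj₂ (v , v≢0 , ψv) = inj₂ (Embedding.to ι v , Embedding.nonZero ι v v≢0 , λ where
          zero    → ψ₀ι v
          (suc e) → ψv e)

-- Quotients of finite sets

record Quotient {d : ℕ} (_~_ : Fin d → Fin d → Set) : Set where
  field
    size    : ℕ
    class   : Fin d → Fin size
    rep     : Fin size → Fin d
    class∘rep : ∀ j → class (rep j) ≡ j
    sound   : ∀ {x y} → x ~ y → class x ≡ class y
    exact   : ∀ {x y} → class x ≡ class y → x ~ y

-- Induction on `d`: point zero either joins the class of a later equivalent point or opens a new
-- class.
quotient : ∀ {d} {_~_ : Fin d → Fin d → Set} → IsEquivalence _~_ → Decidable _~_ → Quotient _~_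
quotient {zero} _ _ = record
  { size = 0 ; class = λ () ; rep = λ () ; class∘rep = λ ()
  ; sound = λ { {()} } ; exact = λ { {()} } }
quotient {suc d} {_~_} eq _~?_ with any? (λ i → zero ~? suc i)
... | yes (i , 0~i) = record
  { size = size ; class = class′ ; rep = suc ∘ rep ; class∘rep = class∘rep
  ; sound = sound′ ; exact = exact′ }
  where
  module E = IsEquivalence eq
  rest : Quotient (λ x y → suc x ~ suc y)
  rest = quotient (record { refl = E.refl ; sym = E.sym ; trans = E.trans }) (λ x y → suc x ~? suc y)
  open Quotient rest
  class′ : Fin (suc d) → Fin size
  class′ zero    = class i
  class′ (suc x) = class x
  sound′ : ∀ {x y} → x ~ y → class′ x ≡ class′ y
  sound′ {zero}  {zero}  _ = refl
  sound′ {zero}  {suc y} r = sound (E.trans (E.sym 0~i) r)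
  sound′ {suc x} {zero}  r = sound (E.trans r 0~i)
  sound′ {suc x} {suc y} r = sound r
  exact′ : ∀ {x y} → class′ x ≡ class′ y → x ~ y
  exact′ {zero}  {zero}  _ = E.refl
  exact′ {zero}  {suc y} r = E.trans 0~i (exact r)
  exact′ {suc x} {zero}  r = E.trans (exact r) (E.sym 0~i)
  exact′ {suc x} {suc y} r = exact r
... | no 0≁ = record
  { size = suc size ; class = class′ ; rep = rep′
  ; class∘rep = λ { zero → refl ; (suc j) → cong suc (class∘rep j) }
  ; sound = sound′ ; exact = exact′ }
  where
  module E = IsEquivalence eq
  rest : Quotient (λ x y → suc x ~ suc y)
  rest = quotient (record { refl = E.refl ; sym = E.sym ; trans = E.trans }) (λ x y → suc x ~? suc y)
  open Quotient rest
  class′ : Fin (suc d) → Fin (suc size)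
  class′ zero    = zero
  class′ (suc x) = suc (class x)
  rep′ : Fin (suc size) → Fin (suc d)
  rep′ zero    = zero
  rep′ (suc j) = suc (rep j)
  sound′ : ∀ {x y} → x ~ y → class′ x ≡ class′ y
  sound′ {zero}  {zero}  _ = refl
  sound′ {zero}  {suc y} r = contradiction (y , r) 0≁
  sound′ {suc x} {zero}  r = contradiction (x , E.sym r) 0≁
  sound′ {suc x} {suc y} r = cong suc (sound r)
  exact′ : ∀ {x y} → class′ x ≡ class′ y → x ~ y
  exact′ {zero}  {zero}  _ = E.refl
  exact′ {suc x} {suc y} r = exact (suc-injective r)

-- Iterates of a periodic map

iter-+ : ∀ {A : Set} (f : A → A) a b x → iter f (a + b) x ≡ iter f a (iter f b x)
iter-+ f zero    b x = refl
iter-+ f (suc a) b x = cong f (iter-+ f a b x)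

iter-multiple : ∀ {A : Set} (f : A → A) k x → iter f k x ≡ x → ∀ m → iter f (m * k) x ≡ x
iter-multiple f k x fᵏx≡x zero    = refl
iter-multiple f k x fᵏx≡x (suc m) =
  trans (iter-+ f k (m * k) x) (trans (cong (iter f k) (iter-multiple f k x fᵏx≡x m)) fᵏx≡x)

iter-% : ∀ {A : Set} (f : A → A) k .{{_ : NonZeroℕ k}} x → iter f k x ≡ x →
         ∀ m → iter f (m % k) x ≡ iter f m x
iter-% f k x fᵏx≡x m = begin
  iter f (m % k) x                        ≡⟨ cong (iter f (m % k)) (iter-multiple f k x fᵏx≡x (m / k)) ⟨
  iter f (m % k) (iter f ((m / k) * k) x) ≡⟨ iter-+ f (m % k) _ x ⟨
  iter f (m % k + (m / k) * k) x          ≡⟨ cong (λ z → iter f z x) (m≡m%n+[m/n]*n m k) ⟨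
  iter f m x                              ∎
  where open ≡-Reasoning

-- Quotient by a free action of ℤ/k

module FreeCyclic {d : ℕ} (f : Fin d → Fin d) (k : ℕ) .{{_ : NonZeroℕ k}}
  (period : ∀ x → iter f k x ≡ x)
  (free : ∀ x (a b : Fin k) → iter f (toℕ a) x ≡ iter f (toℕ b) x → a ≡ b) where

  _~_ : Fin d → Fin d → Set
  x ~ y = ∃[ a ] iter f (toℕ {k} a) x ≡ y

  ~-iter : ∀ m x → x ~ iter f m x
  ~-iter m x = fromℕ< (m%n<n m k) ,
    trans (cong (λ a → iter f a x) (toℕ-fromℕ< (m%n<n m k))) (iter-% f k x (period x) m)

  ~-isEquivalence : IsEquivalence _~_
  ~-isEquivalence = record
    { refl  = λ {x} → ~-iter 0 x
    ; sym   = λ { {x} (a , refl) → subst (iter f (toℕ a) x ~_) (back x a) (~-iter (k ∸ toℕ a) _) }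
    ; trans = λ { {x} (a , refl) (b , refl) →
        subst (x ~_) (iter-+ f (toℕ b) (toℕ a) x) (~-iter (toℕ b + toℕ a) x) }
    }
    where
    back : ∀ x (a : Fin k) → iter f (k ∸ toℕ a) (iter f (toℕ a) x) ≡ x
    back x a = trans (sym (iter-+ f (k ∸ toℕ a) (toℕ a) x))
      (trans (cong (λ m → iter f m x) (ℕₚ.m∸n+n≡m (ℕₚ.<⇒≤ (toℕ<n a)))) (period x))

  open Quotient (quotient ~-isEquivalence (λ x y → any? (λ a → iter f (toℕ a) x ≟ y))) public

  class-step : ∀ x → class (f x) ≡ class x
  class-step x = sym (sound (~-iter 1 x))

  rep∼ : ∀ x → ∃[ a ] x ≡ iter f (toℕ {k} a) (rep (class x))
  rep∼ x with exact (class∘rep (class x))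
  ... | a , e = a , sym e

  module _ {c ℓ} (M : CommutativeMonoid c ℓ) where
    open CommutativeMonoid M using (Carrier; _≈_)
      renaming (refl to ≈-refl; trans to ≈-trans; sym to ≈-sym; reflexive to ≈-reflexive)
    private
      module S = FibreSums M
      open S using (_when_)
    import Algebra.Properties.CommutativeMonoid.Sum M as S′

    -- By freeness, every point is `iter f (toℕ a) (rep j)` for exactly one pair of `j` and `a`.
    sum-orbits : (g : Fin d → Carrier) →
      S′.sum g ≈ S′.sum (λ j → S′.sum (λ a → g (iter f (toℕ {k} a) (rep j))))
    sum-orbits g = ≈-trans (S.sum-fibres class g) (S′.sum-cong-≋ orbit)
      where
      member : ∀ j i → g i when does (class i ≟ j) ≈
                       S′.sum (λ a → g i when does (i ≟ iter f (toℕ {k} a) (rep j)))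
      member j i with class i ≟ j
      ... | no i∉j = ≈-sym (S.sum-zero (λ a → g i when does (i ≟ iter f (toℕ {k} a) (rep j)))
            λ a → ≈-reflexive (cong (g i when_)
              (dec-false (i ≟ _) λ { refl → i∉j (trans (sym (sound (a , refl))) (class∘rep j)) })))
      ... | yes refl with rep∼ i
      ...   | a₀ , e = ≈-sym (≈-trans
              (S′.sum-cong-≋ (λ a → ≈-reflexive (cong (g i when_)
                (does-⇔ (mk⇔ (λ e′ → free _ a a₀ (trans (sym e′) e)) (λ { refl → e }))
                        (i ≟ _) (a ≟ a₀)))))
              (S.sum-pick (λ _ → g i) a₀))
      orbit : ∀ j → S′.sum (λ i → g i when does (class i ≟ j)) ≈
                    S′.sum (λ a → g (iter f (toℕ {k} a) (rep j)))
      orbit j = ≈-trans (S′.sum-cong-≋ (member j))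
        (≈-trans (S′.∑-comm (λ i a → g i when does (i ≟ iter f (toℕ {k} a) (rep j))))
                 (S′.sum-cong-≋ {k} (λ a → S.sum-pick g (iter f (toℕ a) (rep j)))))

  size*k≡d : size * k ≡ d
  size*k≡d = begin
    size * k
      ≡⟨ sum-const size k ⟨
    sum {size} (λ _ → k)
      ≡⟨ sum-cong-≗ {size} (λ _ → trans (sym (ℕₚ.*-identityʳ k)) (sym (sum-const k 1))) ⟩
    sum {size} (λ _ → sum {k} (λ _ → 1))
      ≡⟨ sum-orbits (Semiring.+-commutativeMonoid ℕₚ.+-*-semiring) (λ _ → 1) ⟨
    sum {d} (λ _ → 1)
      ≡⟨ trans (sum-const d 1) (ℕₚ.*-identityʳ d) ⟩
    d ∎
    where open ≡-Reasoning

-- Normalised 0-cochains: functions vanishing at the first point.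

ext : ∀ {m} → Vec Bool (pred m) → Fin m → Bool
ext {suc m} u = lookupᵛ (false ∷ u)

ext-additive : ∀ {m} (j : Fin m) → Additive (λ u → ext u j)
ext-additive {suc m} zero    = additive λ u v → refl
ext-additive {suc m} (suc j) = additive λ u v → lookup-zipWith _xor_ j u v

-- The value at the first point is fixed to `false`, so normalisation removes the constants, which
-- connectedness alone cannot exclude.
ext-const⇒zero : ∀ m (u : Vec Bool (pred m)) → (∀ i j → ext {m} u i ≡ ext {m} u j) → ¬ NonZero u
ext-const⇒zero (suc m) u const (i , uᵢ) with () ← trans (sym uᵢ) (const (suc i) zero)

xor-additive : ∀ {p} {f g : Vec Bool p → Bool} → Additive f → Additive g → Additive (λ u → f u xor g u)
xor-additive {f = f} {g} (additive f-⊞) (additive g-⊞) = additive λ u v →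
  trans (cong₂ _xor_ (f-⊞ u v) (g-⊞ u v)) (xor-interchange (f u) (f v) (g u) (g v))

-- Edges, faces and homology of a triangulation

module Map {n : ℕ} (P : SphereTriangulation n) where
  open SphereTriangulation P

  head : Fin d → Fin n
  head x = tail (α x)

  Adj-sym : ∀ {u w} → Adj P u w → Adj P w u
  Adj-sym (x , p , q) = α x , q , trans (cong tail (α-invol x)) p

  Adj-irrefl : ∀ {u} → ¬ Adj P u u
  Adj-irrefl (x , p , q) = no-loop x (trans q (sym p))

  Adj? : ∀ u w → Dec (Adj P u w)
  Adj? u w = any? (λ x → (tail x ≟ u) ×-dec (head x ≟ w))

  φ : Fin d → Fin d
  φ x = σ (α x)

  φ⁻¹ : Fin d → Fin d
  φ⁻¹ x = α (σ⁻¹ x)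

  φ∘φ⁻¹ : ∀ x → φ (φ⁻¹ x) ≡ x
  φ∘φ⁻¹ x = trans (cong σ (α-invol (σ⁻¹ x))) (σ-right x)

  φ⁻¹∘φ : ∀ x → φ⁻¹ (φ x) ≡ x
  φ⁻¹∘φ x = trans (cong α (σ-left (α x))) (α-invol x)

  tail-φ : ∀ x → tail (φ x) ≡ tail (α x)
  tail-φ x = tail-σ (α x)

  α-free : ∀ x (a b : Fin 2) → iter α (toℕ a) x ≡ iter α (toℕ b) x → a ≡ b
  α-free x zero       zero       _ = refl
  α-free x zero       (suc zero) e = contradiction (sym e) (α-fpf x)
  α-free x (suc zero) zero       e = contradiction e (α-fpf x)
  α-free x (suc zero) (suc zero) _ = refl

  φ²-fpf : ∀ x → φ (φ x) ≢ x
  φ²-fpf x e = face-fpf x (trans (cong φ (sym e)) (face-3 x))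

  φ-free : ∀ x (a b : Fin 3) → iter φ (toℕ a) x ≡ iter φ (toℕ b) x → a ≡ b
  φ-free x zero             zero             _ = refl
  φ-free x zero             (suc zero)       e = contradiction (sym e) (face-fpf x)
  φ-free x zero             (suc (suc zero)) e = contradiction (sym e) (φ²-fpf x)
  φ-free x (suc zero)       zero             e = contradiction e (face-fpf x)
  φ-free x (suc zero)       (suc zero)       _ = refl
  φ-free x (suc zero)       (suc (suc zero)) e = contradiction (sym e) (face-fpf (φ x))
  φ-free x (suc (suc zero)) zero             e = contradiction e (φ²-fpf x)
  φ-free x (suc (suc zero)) (suc zero)       e = contradiction e (face-fpf (φ x))
  φ-free x (suc (suc zero)) (suc (suc zero)) _ = refl

  module Edge = FreeCyclic α 2 α-invol α-free
  module Face = FreeCyclic φ 3 face-3 φ-free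

  sum-φ : (g : Fin d → ℕ) → sum (g ∘ φ) ≡ sum g
  sum-φ g = sym (sum-permute g (permutation φ φ⁻¹ φ∘φ⁻¹ φ⁻¹∘φ))

  ⊕-φ : (g : Fin d → Bool) → ⊕.sum (g ∘ φ) ≡ ⊕.sum g
  ⊕-φ g = sym (⊕.sum-permute g (permutation φ φ⁻¹ φ∘φ⁻¹ φ⁻¹∘φ))

  ⊕-edges : (g : Fin d → Bool) → ⊕.sum (λ e → g (Edge.rep e) xor g (α (Edge.rep e))) ≡ ⊕.sum g
  ⊕-edges g = sym (trans (Edge.sum-orbits (CommutativeRing.+-commutativeMonoid xor-∧-commutativeRing) g)
    (⊕.sum-cong-≗ (λ e → cong (g (Edge.rep e) xor_) (xor-identityʳ _))))

  constant : (κ : Fin d → Bool) → (∀ x → κ (σ x) ≡ κ x) → (∀ x → κ (α x) ≡ κ x) → ∀ x y → κ x ≡ κ y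
  constant κ κσ κα x y = sym (along (connected x y))
    where
    along : ∀ {y} → Reach σ α x y → κ y ≡ κ x
    along here      = refl
    along (stepσ r) = trans (κσ _) (along r)
    along (stepα r) = trans (κα _) (along r)

  cut : (Fin n → Bool) → Fin d → Bool
  cut h x = h (tail x) xor h (tail (α x))

  cut-α : ∀ h x → cut h (α x) ≡ cut h x
  cut-α h x = trans (cong (λ y → h (tail (α x)) xor h (tail y)) (α-invol x)) (xor-comm (h (tail (α x))) _)

  -- A dart chain, regarded as the 1-chain of its underlying edges, with zero boundary.
  IsCycle : (Fin d → Bool) → Set
  IsCycle c = ∀ h → ⊕.sum (λ x → c x ∧ cut h x) ≡ false

  -- The head of a dart is the tail of its `φ`-successor, so the sum over heads equals the sum over
  -- tails and the two cancel modulo 2.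
  face⊥cut : ∀ κ → (∀ x → κ (φ x) ≡ κ x) → IsCycle κ
  face⊥cut κ κφ h = begin
    ⊕.sum (λ x → κ x ∧ cut h x)
      ≡⟨ ⊕.sum-cong-≗ (λ x → ∧-distribˡ-xor (κ x) (h (tail x)) (h (tail (α x)))) ⟩
    ⊕.sum (λ x → (κ x ∧ h (tail x)) xor (κ x ∧ h (tail (α x))))
      ≡⟨ ⊕.∑-distrib-+ (λ x → κ x ∧ h (tail x)) _ ⟩
    ⊕.sum (λ x → κ x ∧ h (tail x)) xor ⊕.sum (λ x → κ x ∧ h (tail (α x)))
      ≡⟨ cong (⊕.sum (λ x → κ x ∧ h (tail x)) xor_)
           (⊕.sum-cong-≗ (λ x → cong₂ (λ b v → b ∧ h v) (sym (κφ x)) (sym (tail-φ x)))) ⟩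
    ⊕.sum (λ x → κ x ∧ h (tail x)) xor ⊕.sum (λ x → κ (φ x) ∧ h (tail (φ x)))
      ≡⟨ cong (⊕.sum (λ x → κ x ∧ h (tail x)) xor_) (⊕-φ (λ x → κ x ∧ h (tail x))) ⟩
    ⊕.sum (λ x → κ x ∧ h (tail x)) xor ⊕.sum (λ x → κ x ∧ h (tail x))
      ≡⟨ xor-same (⊕.sum (λ x → κ x ∧ h (tail x))) ⟩
    false ∎
    where open ≡-Reasoning

  -- Euler's formula: E = (F - 1) + (V - 1).
  dimension : Edge.size < suc (pred Face.size) + pred n
  dimension = count n Face.size three≤n
    (trans Edge.size*k≡d (sym Face.size*k≡d)) (trans (cong (_+ 12) Face.size*k≡d) euler)
    where
    count : ∀ n F {E} → 3 ≤ n → E * 2 ≡ F * 3 → F * 3 + 12 ≡ 6 * n → E < suc (pred F) + pred n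
    -- Without faces Euler's formula would read `12 = 6n`, so `n = 2`, which `3 ≤ n` excludes.
    count (suc (suc zero)) zero (s≤s (s≤s ())) _ _
    count (suc (suc (suc zero))) zero (s≤s (s≤s (s≤s z≤n))) _ ()
    count (suc (suc (suc (suc m)))) zero (s≤s (s≤s (s≤s z≤n))) _ e = contradiction
      (ℕₚ.+-cancelˡ-≡ 12 0 _ (trans e (lemma m))) λ ()
      where
      lemma : ∀ m → 6 * (4 + m) ≡ 12 + suc (11 + 6 * m)
      lemma = solve-∀
    count (suc n) (suc F) {E} _ 2E≡3F 3F≡6n =
      ℕₚ.*-cancelʳ-≤ (suc E) (suc F + n) 2 (ℕₚ.≤-reflexive (ℕₚ.+-cancelʳ-≡ 2 _ _ (begin
        suc E * 2 + 2           ≡⟨ cong (λ m → 2 + m + 2) 2E≡3F ⟩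
        2 + suc F * 3 + 2       ≡⟨ lemma₁ F ⟩
        suc F * 2 + (suc F + 4) ≡⟨ cong (suc F * 2 +_) F+4≡2n ⟩
        suc F * 2 + 2 * suc n   ≡⟨ lemma₂ F n ⟩
        (suc F + n) * 2 + 2     ∎)))
      where
      open ≡-Reasoning
      lemma₁ : ∀ F → 2 + suc F * 3 + 2 ≡ suc F * 2 + (suc F + 4)
      lemma₁ = solve-∀
      lemma₂ : ∀ F n → suc F * 2 + 2 * suc n ≡ (suc F + n) * 2 + 2
      lemma₂ = solve-∀
      lemma₃ : ∀ F → (suc F + 4) * 3 ≡ suc F * 3 + 12
      lemma₃ = solve-∀
      lemma₄ : ∀ n → 6 * suc n ≡ 2 * suc n * 3
      lemma₄ = solve-∀
      F+4≡2n : suc F + 4 ≡ 2 * suc n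
      F+4≡2n = ℕₚ.*-cancelʳ-≡ _ _ 3 (trans (lemma₃ F) (trans 3F≡6n (lemma₄ n)))

  -- H₁(S²; 𝔽₂) = 0.
  abstract
    cycle-bounds : (c : Fin d → Bool) → IsCycle c →
      Σ (Fin d → Bool) λ κ → (∀ x → κ (φ x) ≡ κ x) × (∀ x → κ x xor κ (α x) ≡ c x xor c (α x))
    cycle-bounds c ∂c≡0 = [ fromKernel , ⊥-elim ∘ noCutKernel ]′
      (orthogonal-kernel Edge.size (suc (pred Face.size)) (pred n) dimension ∂ δ ∂-⊞ δ-⊞ ∂⊥δ)
      where
      -- Besides the normalised face colourings, coordinate `t` admits the chain `c` itself. This
      -- extra dimension makes the total exceed the number of edges.
      potential : Vec Bool (suc (pred Face.size)) → Fin d → Bool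
      potential (t ∷ u) x = ext u (Face.class x) xor (t ∧ c x)

      potential-⊞ : ∀ x → Additive (λ u → potential u x)
      potential-⊞ x = additive λ { (s ∷ u) (t ∷ v) → trans
        (cong₂ _xor_ (⊞-homo (ext-additive (Face.class x)) u v) (∧-distribʳ-xor (c x) s t))
        (xor-interchange (ext u (Face.class x)) (ext v (Face.class x)) (s ∧ c x) (t ∧ c x)) }

      ∂ : Fin Edge.size → Vec Bool (suc (pred Face.size)) → Bool
      ∂ e u = potential u (Edge.rep e) xor potential u (α (Edge.rep e))

      δ : Fin Edge.size → Vec Bool (pred n) → Bool
      δ e v = cut (ext v) (Edge.rep e)

      ∂-⊞ : ∀ e → Additive (∂ e)
      ∂-⊞ e = xor-additive (potential-⊞ (Edge.rep e)) (potential-⊞ (α (Edge.rep e)))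

      δ-⊞ : ∀ e → Additive (δ e)
      δ-⊞ e = xor-additive (ext-additive (tail (Edge.rep e))) (ext-additive (tail (α (Edge.rep e))))

      potential-cycle : ∀ u → IsCycle (potential u)
      potential-cycle (t ∷ u) h = begin
        ⊕.sum (λ x → potential (t ∷ u) x ∧ cut h x)
          ≡⟨ ⊕.sum-cong-≗ (λ x → trans (∧-distribʳ-xor (cut h x) (ext u (Face.class x)) (t ∧ c x))
               (cong ((ext u (Face.class x) ∧ cut h x) xor_) (∧-assoc t (c x) (cut h x)))) ⟩
        ⊕.sum (λ x → (ext u (Face.class x) ∧ cut h x) xor (t ∧ (c x ∧ cut h x)))
          ≡⟨ ⊕.∑-distrib-+ (λ x → ext u (Face.class x) ∧ cut h x) _ ⟩
        ⊕.sum (λ x → ext u (Face.class x) ∧ cut h x) xor ⊕.sum (λ x → t ∧ (c x ∧ cut h x))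
          ≡⟨ cong₂ _xor_ (face⊥cut (ext u ∘ Face.class) (λ x → cong (ext u) (Face.class-step x)) h)
               (sym (⊕.*-distribˡ-sum t (λ x → c x ∧ cut h x))) ⟩
        t ∧ ⊕.sum (λ x → c x ∧ cut h x)
          ≡⟨ cong (t ∧_) (∂c≡0 h) ⟩
        t ∧ false
          ≡⟨ ∧-zeroʳ t ⟩
        false ∎
        where open ≡-Reasoning

      -- Since `cut` is `α`-invariant, the sum over edges unfolds to a sum over darts, where
      -- `potential u` is a cycle.
      ∂⊥δ : ∀ u v → ⊕.sum (λ e → ∂ e u ∧ δ e v) ≡ false
      ∂⊥δ u v = begin
        ⊕.sum (λ e → ∂ e u ∧ δ e v)
          ≡⟨ ⊕.sum-cong-≗ (λ e → let r = Edge.rep e in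
               trans (∧-distribʳ-xor (cut (ext v) r) (potential u r) (potential u (α r)))
                     (cong (λ b → (potential u r ∧ cut (ext v) r) xor (potential u (α r) ∧ b))
                         (sym (cut-α (ext v) r)))) ⟩
        ⊕.sum (λ e → (potential u (Edge.rep e) ∧ cut (ext v) (Edge.rep e)) xor
                     (potential u (α (Edge.rep e)) ∧ cut (ext v) (α (Edge.rep e))))
          ≡⟨ ⊕-edges (λ x → potential u x ∧ cut (ext v) x) ⟩
        ⊕.sum (λ x → potential u x ∧ cut (ext v) x)
          ≡⟨ potential-cycle u (ext v) ⟩
        false ∎
        where open ≡-Reasoning
      -- A vertex function cutting no edge is constant by connectedness, hence zero by
      -- normalisation.
      noCutKernel : ¬ Kernel δ
      noCutKernel (v , v≢0 , δv≡0) = contradiction v≢0 (ext-const⇒zero n v constant-v)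
        where
        flat : ∀ x → cut (ext v) x ≡ false
        flat x with Edge.rep∼ x
        ... | zero     , e = trans (cong (cut (ext v)) e) (δv≡0 (Edge.class x))
        ... | suc zero , e = trans (cong (cut (ext v)) e) (trans (cut-α (ext v) _) (δv≡0 (Edge.class x)))
        constant-v : (i j : Fin n) → ext v i ≡ ext v j
        constant-v i j with tail-surj i | tail-surj j
        ... | x , refl | y , refl = constant (ext v ∘ tail) (λ x → cong (ext v) (tail-σ x))
          (λ x → sym (xor-cancelled (flat x))) x y
      fromKernel : Kernel ∂ →
        Σ (Fin d → Bool) λ κ → (∀ x → κ (φ x) ≡ κ x) × (∀ x → κ x xor κ (α x) ≡ c x xor c (α x))
      -- A dependency with `t` true exhibits `c` as a sum of face boundaries. With `t` false it is a
      -- face colouring that never changes across an edge, so it is constant and therefore zero.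
      fromKernel (t ∷ u , tu≢0 , ∂≡0) = separate t tu≢0 flat
        where
        κ : Bool → Fin d → Bool
        κ t x = ext u (Face.class x) xor (t ∧ c x)
        flat : ∀ x → κ t x xor κ t (α x) ≡ false
        flat x with Edge.rep∼ x
        ... | zero     , e = trans (cong (λ y → κ t y xor κ t (α y)) e) (∂≡0 (Edge.class x))
        ... | suc zero , e = trans (cong (λ y → κ t y xor κ t (α y)) e)
          (trans (xor-comm (κ t (α (Edge.rep (Edge.class x)))) _)
            (trans (cong (λ y → κ t y xor κ t (α (Edge.rep (Edge.class x)))) (α-invol _)) (∂≡0 (Edge.class x))))
        ext-φ : ∀ x → ext u (Face.class (φ x)) ≡ ext u (Face.class x)
        ext-φ x = cong (ext u) (Face.class-step x)
        separate : ∀ t → NonZero (t ∷ u) → (∀ x → κ t x xor κ t (α x) ≡ false) →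
          Σ (Fin d → Bool) λ κ → (∀ x → κ (φ x) ≡ κ x) × (∀ x → κ x xor κ (α x) ≡ c x xor c (α x))
        separate true _ flat = ext u ∘ Face.class , ext-φ , λ x → xor-cancelled (trans
          (xor-interchange (ext u (Face.class x)) _ (c x) _) (flat x))
        separate false (suc i , uᵢ) flat = contradiction (i , uᵢ) (ext-const⇒zero Face.size u λ i j →
          trans (cong (ext u) (sym (Face.class∘rep i)))
            (trans (constant (ext u ∘ Face.class)
                     (λ x → trans (cong (ext u ∘ Face.class ∘ σ) (sym (α-invol x))) (trans (ext-φ (α x)) (ext-α x)))
                     ext-α (Face.rep i) (Face.rep j))
                   (cong (ext u) (Face.class∘rep j))))
          where
          ext-α : ∀ x → ext u (Face.class (α x)) ≡ ext u (Face.class x)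
          ext-α x = sym (trans (sym (xor-identityʳ _)) (trans (xor-cancelled (flat x)) (xor-identityʳ _)))

least : ∀ {Q : ℕ → Set} → U.Decidable Q → ∀ k → Q k → ∃[ m ] Q m × (∀ i → i < m → ¬ Q i)
least Q? k Qk with Q? 0
... | yes Q0 = 0 , Q0 , λ _ ()
least Q? zero    Q0 | no ¬Q0 = contradiction Q0 ¬Q0
least {Q} Q? (suc k) Qk | no ¬Q0 with least (Q? ∘ suc) k Qk
... | m , Qm , min = suc m , Qm , below
  where
  below : ∀ i → i < suc m → ¬ Q i
  below zero    _         = ¬Q0
  below (suc i) (s≤s i<m) = min i i<m

-- The link of a vertex

module Link {n : ℕ} (P : SphereTriangulation n) (x₀ : Fin (SphereTriangulation.d P)) where
  open SphereTriangulation P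
  open Map P

  v : Fin n
  v = tail x₀

  spoke : ℕ → Fin d
  spoke i = iter σ i x₀

  rim : ℕ → Fin n
  rim i = head (spoke i)

  private
    return : ∃[ m ] spoke (suc m) ≡ x₀ × (∀ i → i < m → spoke (suc i) ≢ x₀)
    -- Starting from `σ x₀` makes the return time positive; the least such time is the degree.
    return with tail-orbit (σ x₀) x₀ (tail-σ x₀)
    ... | k , e = least (λ m → spoke (suc m) ≟ x₀) k
      (trans (cong (λ m → iter σ m x₀) (ℕₚ.+-comm 1 k)) (trans (iter-+ σ k 1 x₀) e))

  deg : ℕ
  deg = suc (proj₁ return)

  spoke-deg : spoke deg ≡ x₀
  spoke-deg = proj₁ (proj₂ return)

  spoke-fpf : ∀ i → 0 < i → i < deg → spoke i ≢ x₀
  spoke-fpf (suc i) _ (s≤s i<m) = proj₂ (proj₂ return) i i<m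

  σ-injective : ∀ {x y} → σ x ≡ σ y → x ≡ y
  σ-injective {x} {y} e = trans (sym (σ-left x)) (trans (cong σ⁻¹ e) (σ-left y))

  spoke-≢ : ∀ i j → i < j → j < deg → spoke i ≢ spoke j
  spoke-≢ zero    j       0<j       j<D e = spoke-fpf j 0<j j<D (sym e)
  spoke-≢ (suc i) (suc j) (s≤s i<j) j<D e = spoke-≢ i j i<j (ℕₚ.<⇒≤ j<D) (σ-injective e)

  tail-spoke : ∀ i → tail (spoke i) ≡ v
  tail-spoke zero    = refl
  tail-spoke (suc i) = trans (tail-σ (spoke i)) (tail-spoke i)

  rim-≢ : ∀ {i j} → i < deg → j < deg → i ≢ j → rim i ≢ rim j
  rim-≢ {i} {j} i<D j<D i≢j e
    with s ← no-multi (spoke i) (spoke j) (trans (tail-spoke i) (sym (tail-spoke j))) e | ℕₚ.<-cmp i j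
  ... | tri< i<j _ _ = spoke-≢ i j i<j j<D s
  ... | tri≈ _ i≡j _ = i≢j i≡j
  ... | tri> _ _ j<i = spoke-≢ j i j<i i<D (sym s)

  rim≢v : ∀ i → rim i ≢ v
  rim≢v i e = no-loop (spoke i) (trans e (sym (tail-spoke i)))

  v-rim : ∀ i → Adj P v (rim i)
  v-rim i = spoke i , tail-spoke i , refl

  dart-position : ∀ y → tail y ≡ v → ∃[ i ] i < deg × spoke i ≡ y
  dart-position y y∈v with tail-orbit x₀ y (sym y∈v)
  ... | k , e = k % deg , m%n<n k deg , trans (iter-% σ deg x₀ spoke-deg k) e

  position : ∀ {u} → Adj P v u → ∃[ i ] i < deg × rim i ≡ u
  position (y , p , q) with dart-position y p
  ... | i , i<D , e = i , i<D , trans (cong head e) q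

  -- The face through `spoke (suc i)` ends with `α (spoke i)`; its middle dart runs from
  -- `rim (suc i)` to `rim i`.
  rim-step : ∀ i → Adj P (rim i) (rim (suc i))
  rim-step i = Adj-sym (φ y , tail-φ y , trans (sym (tail-φ (φ y))) (cong tail φφy))
    where
    y = spoke (suc i)
    φφy : φ (φ y) ≡ α (spoke i)
    φφy = trans (cong (φ ∘ φ ∘ σ) (sym (α-invol (spoke i)))) (face-3 (α (spoke i)))

  -- The 3-cycle v, rim lo, rim hi bounds a 2-colouring of the faces; this is
  -- the Jordan curve theorem for it.
  module Separation {lo hi : ℕ} (lo<hi : lo < hi) (hi<D : hi < deg) (chord : Adj P (rim lo) (rim hi)) where

    Off : Fin n → Set
    Off w = w ≢ v × w ≢ rim lo × w ≢ rim hi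

    private
      z = proj₁ chord

      tail-z : tail z ≡ rim lo
      tail-z = proj₁ (proj₂ chord)

      head-z : head z ≡ rim hi
      head-z = proj₂ (proj₂ chord)

      spoke≢z : ∀ i → spoke i ≢ z
      spoke≢z i e = rim≢v lo (trans (sym tail-z) (trans (cong tail (sym e)) (tail-spoke i)))

      αspoke≢z : ∀ i → α (spoke i) ≢ z
      αspoke≢z i e = rim≢v hi (trans (sym head-z)
        (trans (cong head (sym e)) (trans (cong tail (α-invol (spoke i))) (tail-spoke i))))

      lo<D : lo < deg
      lo<D = ℕₚ.<-trans lo<hi hi<D

      -- One dart per edge of the 3-cycle; modulo 2 only the underlying edges matter.
      c : Fin d → Bool
      c y = does (y ≟ spoke lo) xor (does (y ≟ z) xor does (y ≟ spoke hi))

      ∧-when : ∀ b a → b ∧ a ≡ (if b then a else false)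
      ∧-when true  _ = refl
      ∧-when false _ = refl

      pick : (g : Fin d → Bool) (j : Fin d) → ⊕.sum (λ y → does (y ≟ j) ∧ g y) ≡ g j
      pick g j = trans (⊕.sum-cong-≗ (λ y → ∧-when (does (y ≟ j)) (g y))) (⊕ᶠ.sum-pick g j)

      xor-triangle : ∀ a b e → (a xor b) xor ((b xor e) xor (a xor e)) ≡ false
      xor-triangle true  true  true  = refl
      xor-triangle true  true  false = refl
      xor-triangle true  false true  = refl
      xor-triangle true  false false = refl
      xor-triangle false true  true  = refl
      xor-triangle false true  false = refl
      xor-triangle false false true  = refl
      xor-triangle false false false = refl

      -- In the sum of the three cuts each corner of the triangle appears twice.
      c-cycle : IsCycle c
      c-cycle h = begin
        ⊕.sum (λ y → c y ∧ cut h y)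
          ≡⟨ ⊕.sum-cong-≗ (λ y → trans
               (∧-distribʳ-xor (cut h y) (does (y ≟ spoke lo)) (does (y ≟ z) xor does (y ≟ spoke hi)))
               (cong (at (spoke lo) y xor_)
                 (∧-distribʳ-xor (cut h y) (does (y ≟ z)) (does (y ≟ spoke hi))))) ⟩
        ⊕.sum (λ y → at (spoke lo) y xor (at z y xor at (spoke hi) y))
          ≡⟨ ⊕.∑-distrib-+ (at (spoke lo)) (λ y → at z y xor at (spoke hi) y) ⟩
        ⊕.sum (at (spoke lo)) xor ⊕.sum (λ y → at z y xor at (spoke hi) y)
          ≡⟨ cong₂ _xor_ (pick (cut h) (spoke lo)) (trans (⊕.∑-distrib-+ (at z) (at (spoke hi)))
               (cong₂ _xor_ (pick (cut h) z) (pick (cut h) (spoke hi)))) ⟩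
        cut h (spoke lo) xor (cut h z xor cut h (spoke hi))
          ≡⟨ cong₂ _xor_ (cong (λ w → h w xor h (rim lo)) (tail-spoke lo))
               (cong₂ _xor_ (cong₂ (λ w w′ → h w xor h w′) tail-z head-z)
                            (cong (λ w → h w xor h (rim hi)) (tail-spoke hi))) ⟩
        (h v xor h (rim lo)) xor ((h (rim lo) xor h (rim hi)) xor (h v xor h (rim hi)))
          ≡⟨ xor-triangle (h v) (h (rim lo)) (h (rim hi)) ⟩
        false ∎
        where
        open ≡-Reasoning
        at : Fin d → Fin d → Bool
        at j y = does (y ≟ j) ∧ cut h y

      colouring = cycle-bounds c c-cycle
      κ  = proj₁ colouring
      κφ = proj₁ (proj₂ colouring)

      κα : ∀ x → κ (α x) ≡ κ x xor (c x xor c (α x))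
      κα x = begin
        κ (α x)                     ≡⟨ cong (_xor κ (α x)) (xor-same (κ x)) ⟨
        (κ x xor κ x) xor κ (α x)   ≡⟨ xor-assoc (κ x) (κ x) _ ⟩
        κ x xor (κ x xor κ (α x))   ≡⟨ cong (κ x xor_) (proj₂ (proj₂ colouring) x) ⟩
        κ x xor (c x xor c (α x))   ∎
        where open ≡-Reasoning

      -- `σ x` follows `α x` on its face, so turning from `x` to `σ x` amounts to crossing the edge
      -- of `x`.
      κσ : ∀ x → κ (σ x) ≡ κ (α x)
      κσ x = trans (cong (κ ∘ σ) (sym (α-invol x))) (κφ (α x))

      c-false : ∀ y → y ≢ spoke lo → y ≢ z → y ≢ spoke hi → c y ≡ false
      c-false y p q r = trans
        (cong₂ (λ a b → a xor (b xor does (y ≟ spoke hi))) (dec-false (y ≟ spoke lo) p) (dec-false (y ≟ z) q))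
        (dec-false (y ≟ spoke hi) r)

      κα-same : ∀ {x} → c x ≡ false → c (α x) ≡ false → κ (α x) ≡ κ x
      κα-same {x} p q = trans (κα x) (trans (cong₂ (λ a b → κ x xor (a xor b)) p q) (xor-identityʳ (κ x)))

      κα-flip : ∀ {x} → c x ≡ true → c (α x) ≡ false → κ (α x) ≡ not (κ x)
      κα-flip {x} p q = trans (κα x) (trans (cong₂ (λ a b → κ x xor (a xor b)) p q) (xor-comm (κ x) true))

      κα-off : ∀ y → Off (tail y) → κ (α y) ≡ κ y
      κα-off y (≢v , ≢lo , ≢hi) = κα-same {y}
        (c-false y (λ { refl → ≢v (tail-spoke lo) }) (λ { refl → ≢lo tail-z })
                   (λ { refl → ≢v (tail-spoke hi) }))
        (c-false (α y) (λ e → ≢lo (at e)) (λ e → ≢hi (trans (at e) head-z)) (λ e → ≢hi (at e)))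
        where
        at : ∀ {x} → α y ≡ x → tail y ≡ head x
        at e = cong tail (trans (sym (α-invol y)) (cong α e))

      κα-spoke : ∀ i → i < deg → i ≢ lo → i ≢ hi → κ (α (spoke i)) ≡ κ (spoke i)
      κα-spoke i i<D i≢lo i≢hi = κα-same
        (c-false (spoke i) (λ e → rim-≢ i<D lo<D i≢lo (cong head e))
                 (spoke≢z i)
                 (λ e → rim-≢ i<D hi<D i≢hi (cong head e)))
        (c-false (α (spoke i)) (λ e → rim≢v i (trans (cong tail e) (tail-spoke lo)))
                 (αspoke≢z i)
                 (λ e → rim≢v i (trans (cong tail e) (tail-spoke hi))))

      κα-lo : κ (α (spoke lo)) ≡ not (κ (spoke lo))
      κα-lo = κα-flip
        (cong₂ _xor_ (dec-true (spoke lo ≟ _) refl)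
          (cong₂ _xor_ (dec-false (spoke lo ≟ _) (spoke≢z lo))
                       (dec-false (spoke lo ≟ _) (spoke-≢ lo hi lo<hi hi<D))))
        (c-false (α (spoke lo)) (λ e → rim≢v lo (trans (cong tail e) (tail-spoke lo)))
                 (αspoke≢z lo)
                 (λ e → rim≢v lo (trans (cong tail e) (tail-spoke hi))))

      κα-hi : κ (α (spoke hi)) ≡ not (κ (spoke hi))
      κα-hi = κα-flip
        (cong₂ _xor_ (dec-false (spoke hi ≟ _) (spoke-≢ lo hi lo<hi hi<D ∘ sym))
          (cong₂ _xor_ (dec-false (spoke hi ≟ _) (spoke≢z hi))
                       (dec-true (spoke hi ≟ _) refl)))
        (c-false (α (spoke hi)) (λ e → rim≢v hi (trans (cong tail e) (tail-spoke lo)))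
                 (αspoke≢z hi)
                 (λ e → rim≢v hi (trans (cong tail e) (tail-spoke hi))))

    -- At a vertex off the 3-cycle all darts have one colour, so any dart may be sampled; on the
    -- 3-cycle the value carries no meaning.
    colour : Fin n → Bool
    colour w = κ (proj₁ (tail-surj w))

    outer : Bool
    outer = κ x₀

    private
      κ-iter : ∀ y k → Off (tail y) → κ (iter σ k y) ≡ κ y
      κ-iter y zero    off = refl
      κ-iter y (suc k) off = trans (κσ (iter σ k y))
        (trans (κα-off (iter σ k y) (subst Off (sym (tail-iter k)) off)) (κ-iter y k off))
        where
        tail-iter : ∀ k → tail (iter σ k y) ≡ tail y
        tail-iter zero    = refl
        tail-iter (suc k) = trans (tail-σ _) (tail-iter k)

      colour-tail : ∀ y → Off (tail y) → colour (tail y) ≡ κ y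
      colour-tail y off =
        let k , e = tail-orbit y (proj₁ (tail-surj (tail y))) (sym (proj₂ (tail-surj (tail y))))
        in trans (cong κ (sym e)) (κ-iter y k off)

      -- `κ (spoke i)` is the colour just before spoke `i` is crossed. The jump at `lo` shows only
      -- from `suc lo` on, hence `i ≤ lo` here but `lo < i` in `κ-between`.
      κ-before : ∀ i → i ≤ lo → κ (spoke i) ≡ outer
      κ-before zero    _    = refl
      κ-before (suc i) i<lo = trans (κσ (spoke i)) (trans
        (κα-spoke i (ℕₚ.<-trans i<lo lo<D) (ℕₚ.<⇒≢ i<lo) (ℕₚ.<⇒≢ (ℕₚ.<-trans i<lo lo<hi)))
        (κ-before i (ℕₚ.<⇒≤ i<lo)))

      κ-between : ∀ i → lo < i → i ≤ hi → κ (spoke i) ≡ not outer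
      κ-between (suc i) (s≤s lo≤i) i<hi = trans (κσ (spoke i)) ([ (λ lo<i → trans
          (κα-spoke i (ℕₚ.<-trans i<hi hi<D) (ℕₚ.>⇒≢ lo<i) (ℕₚ.<⇒≢ i<hi))
          (κ-between i lo<i (ℕₚ.<⇒≤ i<hi)))
        , (λ { refl → trans κα-lo (cong not (κ-before lo ℕₚ.≤-refl)) })
        ]′ (ℕₚ.m≤n⇒m<n∨m≡n lo≤i))

      κ-after : ∀ i → hi < i → i < deg → κ (spoke i) ≡ outer
      κ-after (suc i) (s≤s hi≤i) i<D = trans (κσ (spoke i)) ([ (λ hi<i → trans
          (κα-spoke i (ℕₚ.<⇒≤ i<D) (ℕₚ.>⇒≢ (ℕₚ.<-trans lo<hi hi<i)) (ℕₚ.>⇒≢ hi<i))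
          (κ-after i hi<i (ℕₚ.<⇒≤ i<D)))
        , (λ { refl → trans κα-hi (trans (cong not (κ-between hi lo<hi ℕₚ.≤-refl)) (not-involutive outer)) })
        ]′ (ℕₚ.m≤n⇒m<n∨m≡n hi≤i))

      colour-rim : ∀ i → i < deg → i ≢ lo → i ≢ hi → colour (rim i) ≡ κ (spoke i)
      colour-rim i i<D i≢lo i≢hi = trans
        (colour-tail (α (spoke i)) (rim≢v i , rim-≢ i<D lo<D i≢lo , rim-≢ i<D hi<D i≢hi))
        (κα-spoke i i<D i≢lo i≢hi)

    -- An edge with an end off the 3-cycle is none of its three edges, so both sides of it have the
    -- same colour. This is the separation property.
    colour-adj : ∀ {w w′} → Adj P w w′ → Off w → Off w′ → colour w ≡ colour w′
    colour-adj (y , refl , refl) off off′ =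
      trans (colour-tail y off) (trans (sym (κα-off y off)) (sym (colour-tail (α y) off′)))

    colour-before : ∀ i → i < lo → colour (rim i) ≡ outer
    colour-before i i<lo = trans
      (colour-rim i (ℕₚ.<-trans i<lo lo<D) (ℕₚ.<⇒≢ i<lo) (ℕₚ.<⇒≢ (ℕₚ.<-trans i<lo lo<hi)))
      (κ-before i (ℕₚ.<⇒≤ i<lo))

    colour-between : ∀ i → lo < i → i < hi → colour (rim i) ≡ not outer
    colour-between i lo<i i<hi = trans
      (colour-rim i (ℕₚ.<-trans i<hi hi<D) (ℕₚ.>⇒≢ lo<i) (ℕₚ.<⇒≢ i<hi))
      (κ-between i lo<i (ℕₚ.<⇒≤ i<hi))

    colour-after : ∀ i → hi < i → i < deg → colour (rim i) ≡ outer
    colour-after i hi<i i<D = trans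
      (colour-rim i i<D (ℕₚ.>⇒≢ (ℕₚ.<-trans lo<hi hi<i)) (ℕₚ.>⇒≢ hi<i))
      (κ-after i hi<i i<D)

    off-rim : ∀ {i} → i < deg → i ≢ lo → i ≢ hi → Off (rim i)
    off-rim {i} i<D i≢lo i≢hi = rim≢v i , rim-≢ i<D lo<D i≢lo , rim-≢ i<D hi<D i≢hi

  -- The chord closes a 3-cycle with `v`, and off this cycle `rim m` and `rim i` receive opposite
  -- colours.
  no-crossing : ∀ {lo m hi i} → lo < m → m < hi → hi < deg → i < deg → i < lo ⊎ hi < i →
                Adj P (rim lo) (rim hi) → ¬ Adj P (rim m) (rim i)
  no-crossing {lo} {m} {hi} {i} lo<m m<hi hi<D i<D outside chord m~i =
    not-¬ refl (trans (sym (outside-colour outside)) (trans (sym (colour-adj m~i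
      (off-rim (ℕₚ.<-trans m<hi hi<D) (ℕₚ.>⇒≢ lo<m) (ℕₚ.<⇒≢ m<hi))
      (off-rim i<D (i≢lo outside) (i≢hi outside)))) (colour-between m lo<m m<hi)))
    where
    lo<hi = ℕₚ.<-trans lo<m m<hi
    open Separation lo<hi hi<D chord
    outside-colour : i < lo ⊎ hi < i → colour (rim i) ≡ outer
    outside-colour (inj₁ i<lo) = colour-before i i<lo
    outside-colour (inj₂ hi<i) = colour-after i hi<i i<D
    i≢lo : i < lo ⊎ hi < i → i ≢ lo
    i≢lo (inj₁ i<lo) = ℕₚ.<⇒≢ i<lo
    i≢lo (inj₂ hi<i) = ℕₚ.>⇒≢ (ℕₚ.<-trans lo<hi hi<i)
    i≢hi : i < lo ⊎ hi < i → i ≢ hi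
    i≢hi (inj₁ i<lo) = ℕₚ.<⇒≢ (ℕₚ.<-trans i<lo lo<hi)
    i≢hi (inj₂ hi<i) = ℕₚ.>⇒≢ hi<i

-- Chords of the link cycle

module Arcs {n : ℕ} (P : SphereTriangulation n) (x₀ : Fin (SphereTriangulation.d P)) where
  open Map P
  open Link P x₀

  -- Every common neighbour of `v` and `rim (suc lo)` lies in the link. Two are the neighbours along
  -- the rim, distinct because `suc (suc lo) < deg`; a third would be the far end of a chord.
  contractible-or-chord : ∀ lo → suc (suc lo) < deg →
    ContractibleInP P v (rim (suc lo)) ⊎
    ∃[ i ] i < deg × Adj P (rim (suc lo)) (rim i) × i ≢ lo × i ≢ suc (suc lo)
  contractible-or-chord lo lo+2<D = decide (any? λ u →
    Adj? v u ×-dec (Adj? (rim (suc lo)) u ×-dec (¬? (u ≟ rim lo) ×-dec ¬? (u ≟ rim (suc (suc lo))))))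
    where
    Third : Fin n → Set
    Third u = Adj P v u × Adj P (rim (suc lo)) u × u ≢ rim lo × u ≢ rim (suc (suc lo))

    decide : Dec (∃ Third) →
      ContractibleInP P v (rim (suc lo)) ⊎
      ∃[ i ] i < deg × Adj P (rim (suc lo)) (rim i) × i ≢ lo × i ≢ suc (suc lo)
    decide (yes (u , v~u , m~u , u≢lo , u≢lo+2)) =
      let i , i<D , e = position v~u
      in inj₂ (i , i<D , subst (Adj P _) (sym e) m~u ,
               (λ i≡lo → u≢lo (trans (sym e) (cong rim i≡lo))) ,
               (λ i≡lo+2 → u≢lo+2 (trans (sym e) (cong rim i≡lo+2))))
    decide (no none) = inj₁ (v-rim (suc lo) , rim lo , rim (suc (suc lo)) ,
      rim-≢ (ℕₚ.<⇒≤ (ℕₚ.<⇒≤ lo+2<D)) lo+2<D (ℕₚ.<⇒≢ (s≤s (ℕₚ.n≤1+n lo))) ,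
      (v-rim lo , Adj-sym (rim-step lo)) , (v-rim (suc (suc lo)) , rim-step (suc lo)) , only)
      where
      only : ∀ z → Adj P v z → Adj P (rim (suc lo)) z → z ≡ rim lo ⊎ z ≡ rim (suc (suc lo))
      only z v~z m~z with z ≟ rim lo | z ≟ rim (suc (suc lo))
      ... | yes p | _     = inj₁ p
      ... | no  _ | yes q = inj₂ q
      ... | no  p | no  q = contradiction (z , v~z , m~z , p , q) none

  ArcContractible : ℕ → ℕ → Set
  ArcContractible lo hi = ∃[ i ] lo < i × i < hi × ContractibleInP P v (rim i)

  -- An innermost chord inside the arc leaves a rim vertex without chords.
  arc-contractible : ∀ k lo hi → hi ≤ k + lo → suc lo < hi → hi < deg →
                     Adj P (rim lo) (rim hi) → ArcContractible lo hi
  arc-contractible zero    lo hi hi≤lo   lo+1<hi = contradiction hi≤lo (ℕₚ.<⇒≱ (ℕₚ.<⇒≤ lo+1<hi))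
  -- The fuel `k` bounds the length of the arc. A chord from `rim (suc lo)` cannot cross the given
  -- one, so it ends at some `i` with `suc (suc lo) < i ≤ hi` and spans a shorter arc.
  arc-contractible (suc k) lo hi hi≤k+lo lo+1<hi hi<D chord =
    [ (λ m-contractible → suc lo , ℕₚ.≤-refl , lo+1<hi , m-contractible)
    , (λ { (i , i<D , m~i , i≢lo , i≢lo+2) → shrink i i<D m~i i≢lo i≢lo+2 (lo ℕₚ.<? i) (i ℕₚ.≤? hi) })
    ]′ (contractible-or-chord lo (ℕₚ.≤-<-trans lo+1<hi hi<D))
    where
    shrink : ∀ i → i < deg → Adj P (rim (suc lo)) (rim i) → i ≢ lo → i ≢ suc (suc lo) →
             Dec (lo < i) → Dec (i ≤ hi) → ArcContractible lo hi
    shrink i i<D m~i i≢lo i≢lo+2 (no lo≮i) _ = contradiction m~i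
      (no-crossing ℕₚ.≤-refl lo+1<hi hi<D i<D (inj₁ (ℕₚ.≤∧≢⇒< (ℕₚ.≮⇒≥ lo≮i) i≢lo)) chord)
    shrink i i<D m~i i≢lo i≢lo+2 (yes _) (no i≰hi) = contradiction m~i
      (no-crossing ℕₚ.≤-refl lo+1<hi hi<D i<D (inj₂ (ℕₚ.≰⇒> i≰hi)) chord)
    shrink i i<D m~i i≢lo i≢lo+2 (yes lo<i) (yes i≤hi) =
      let lo+2<i = ℕₚ.≤∧≢⇒< (ℕₚ.≤∧≢⇒< lo<i λ { refl → Adj-irrefl m~i }) (i≢lo+2 ∘ sym)
          i′ , lo+1<i′ , i′<i , contr = arc-contractible k (suc lo) i
            (ℕₚ.≤-trans i≤hi (ℕₚ.≤-trans hi≤k+lo (ℕₚ.≤-reflexive (sym (ℕₚ.+-suc k lo))))) lo+2<i i<D m~i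
      in i′ , ℕₚ.<⇒≤ lo+1<i′ , ℕₚ.<-≤-trans i′<i i≤hi , contr

-- Small degrees and finite counting

𝟙 : Bool → ℕ
𝟙 b = if b then 1 else 0

sum-𝟙 : ∀ {n} (a : Fin n) → sum (λ w → 𝟙 (does (w ≟ a))) ≡ 1
sum-𝟙 = +ᶠ.sum-pick (λ _ → 1)

sum-cover₃ : ∀ {n} (q : Fin n → Bool) (a b c : Fin n) →
  (∀ w → q w ≡ true → w ≡ a ⊎ w ≡ b ⊎ w ≡ c) → sum (𝟙 ∘ q) ≤ 3
sum-cover₃ {n} q a b c cover = begin
  sum (𝟙 ∘ q)
    ≤⟨ sum-mono-≤ pointwise ⟩
  sum (λ w → at a w + (at b w + at c w))
    ≡⟨ ∑-distrib-+ (at a) (λ w → at b w + at c w) ⟩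
  sum (at a) + sum (λ w → at b w + at c w)
    ≡⟨ cong₂ _+_ (sum-𝟙 a) (trans (∑-distrib-+ (at b) (at c)) (cong₂ _+_ (sum-𝟙 b) (sum-𝟙 c))) ⟩
  3 ∎
  where
  open ℕₚ.≤-Reasoning
  at : Fin n → Fin n → ℕ
  at a w = 𝟙 (does (w ≟ a))
  at-self : ∀ a → 1 ≤ at a a
  at-self a = ℕₚ.≤-reflexive (sym (cong 𝟙 (dec-true (a ≟ a) refl)))
  pointwise : ∀ w → 𝟙 (q w) ≤ at a w + (at b w + at c w)
  pointwise w with q w | cover w
  ... | false | _ = z≤n
  ... | true  | f with f refl
  ...   | inj₁ refl        = ℕₚ.≤-trans (at-self w) (ℕₚ.m≤m+n _ _)
  ...   | inj₂ (inj₁ refl) = ℕₚ.≤-trans (at-self w) (ℕₚ.≤-trans (ℕₚ.m≤m+n _ (at c w)) (ℕₚ.m≤n+m _ (at a w)))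
  ...   | inj₂ (inj₂ refl) = ℕₚ.≤-trans (at-self w) (ℕₚ.≤-trans (ℕₚ.m≤n+m _ (at b w)) (ℕₚ.m≤n+m _ (at a w)))

term≤sum : ∀ {n} (f : Fin n → ℕ) i → f i ≤ sum f
term≤sum f zero    = ℕₚ.m≤m+n _ _
term≤sum f (suc i) = ℕₚ.≤-trans (term≤sum (f ∘ suc) i) (ℕₚ.m≤n+m _ (f zero))

-- By injectivity each point is hit at most once, so after exchanging the sums the hits at a point
-- are bounded by the value of `f` there.
sum-≥ : ∀ {m n} (f : Fin n → ℕ) (y : Fin m → Fin n) → (∀ i j → y i ≡ y j → i ≡ j) →
        (∀ i → 1 ≤ f (y i)) → m ≤ sum f
sum-≥ {m} {n} f y y-inj f≥1 = begin
  m                                              ≡⟨ ℕₚ.*-identityʳ m ⟨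
  m * 1                                          ≡⟨ sum-const m 1 ⟨
  sum {m} (λ _ → 1)                              ≡⟨ sum-cong-≗ (λ i → sym (sum-𝟙 (y i))) ⟩
  sum (λ i → sum (λ x → 𝟙 (does (x ≟ y i))))     ≡⟨ ∑-comm (λ i x → 𝟙 (does (x ≟ y i))) ⟩
  sum (λ x → sum (λ i → 𝟙 (does (x ≟ y i))))     ≤⟨ sum-mono-≤ (λ x → count x (any? (λ i → x ≟ y i))) ⟩
  sum f                                          ∎
  where
  open ℕₚ.≤-Reasoning
  count : ∀ x → Dec (∃[ i ] x ≡ y i) → sum (λ i → 𝟙 (does (x ≟ y i))) ≤ f x
  count x (no x∉y) = ℕₚ.≤-trans
    (ℕₚ.≤-reflexive (+ᶠ.sum-zero (λ i → 𝟙 (does (x ≟ y i)))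
      (λ i → cong 𝟙 (dec-false (x ≟ y i) (λ e → x∉y (i , e))))))
    z≤n
  count x (yes (i , refl)) = ℕₚ.≤-trans
    (ℕₚ.≤-reflexive (trans
      (sum-cong-≗ (λ j → cong 𝟙 (does-⇔ (mk⇔ (λ e → y-inj j i (sym e)) (λ { refl → refl }))
        (y i ≟ y j) (j ≟ i))))
      (sum-𝟙 i)))
    (f≥1 i)

module SmallDegree {n : ℕ} (P : SphereTriangulation n) (4≤n : 4 ≤ n)
                   (x₀ : Fin (SphereTriangulation.d P)) where
  open SphereTriangulation P
  open Map P
  open Link P x₀

  -- If `σ` fixed `x`, the face of `x` would have `α x` as its third dart, making `φ x` a loop at
  -- `head x`.
  σx≢x : ∀ x → σ x ≢ x
  σx≢x x σx≡x = no-loop (φ x) (trans (sym (tail-φ (φ x))) (trans (cong tail φφx) (sym (tail-φ x))))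
    where
    φφx : φ (φ x) ≡ α x
    φφx = trans (cong (φ ∘ φ) (sym (trans (cong σ (α-invol x)) σx≡x))) (face-3 (α x))

  -- Around a vertex of degree 2 the six darts of a single triangle are closed under σ and α.
  σσx≢x : ∀ x → σ (σ x) ≢ x
  σσx≢x x σσx≡x = ℕₚ.<⇒≱ 4≤n (begin
    n                         ≡⟨ ℕₚ.*-identityʳ n ⟨
    n * 1                     ≡⟨ sum-const n 1 ⟨
    sum {n} (λ _ → 1)         ≤⟨ sum-cover₃ (λ _ → true) (tail x) (head x) (head y) (λ w _ → cover w) ⟩
    3                         ∎)
    where
    open ℕₚ.≤-Reasoning
    y = σ x

    φφφα : ∀ z → φ (φ (σ z)) ≡ α z
    φφφα z = trans (cong (φ ∘ φ ∘ σ) (sym (α-invol z))) (face-3 (α z))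

    φφx : φ (φ x) ≡ α y
    φφx = trans (cong (φ ∘ φ) (sym σσx≡x)) (φφφα y)

    head-φx : head (φ x) ≡ head y
    head-φx = trans (sym (tail-φ (φ x))) (cong tail φφx)

    head-φy : head (φ y) ≡ head x
    head-φy = trans (sym (tail-φ (φ y))) (cong tail (φφφα x))

    -- `φ x` and `φ y` run between `head x` and `head y` in opposite directions; simplicity makes
    -- them the two darts of one edge.
    αφx : α (φ x) ≡ φ y
    αφx = no-multi _ _ (trans head-φx (sym (tail-φ y)))
      (trans (cong tail (α-invol (φ x))) (trans (tail-φ x) (sym head-φy)))

    αφy : α (φ y) ≡ φ x
    αφy = trans (cong α (sym αφx)) (α-invol (φ x))

    data Closed : Fin d → Set where
      x∈   : Closed x
      y∈   : Closed y
      αx∈  : Closed (α x)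
      αy∈  : Closed (α y)
      φx∈  : Closed (φ x)
      φy∈  : Closed (φ y)

    closed-σ : ∀ {z} → Closed z → Closed (σ z)
    closed-σ x∈  = y∈
    closed-σ y∈  = subst Closed (sym σσx≡x) x∈
    closed-σ αx∈ = φx∈
    closed-σ αy∈ = φy∈
    closed-σ φx∈ = subst Closed (sym (trans (cong σ (sym αφy)) (φφφα x))) αx∈
    closed-σ φy∈ = subst Closed (sym (trans (cong σ (sym αφx)) φφx)) αy∈

    closed-α : ∀ {z} → Closed z → Closed (α z)
    closed-α x∈  = αx∈
    closed-α y∈  = αy∈
    closed-α αx∈ = subst Closed (sym (α-invol x)) x∈
    closed-α αy∈ = subst Closed (sym (α-invol y)) y∈
    closed-α φx∈ = subst Closed (sym αφx) φy∈
    closed-α φy∈ = subst Closed (sym αφy) φx∈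

    reached : ∀ {z} → Reach σ α x z → Closed z
    reached here      = x∈
    reached (stepσ r) = closed-σ (reached r)
    reached (stepα r) = closed-α (reached r)

    closed-tail : ∀ {z} → Closed z → tail z ≡ tail x ⊎ tail z ≡ head x ⊎ tail z ≡ head y
    closed-tail x∈  = inj₁ refl
    closed-tail y∈  = inj₁ (tail-σ x)
    closed-tail αx∈ = inj₂ (inj₁ refl)
    closed-tail αy∈ = inj₂ (inj₂ refl)
    closed-tail φx∈ = inj₂ (inj₁ (tail-φ x))
    closed-tail φy∈ = inj₂ (inj₂ (tail-φ y))

    cover : ∀ w → w ≡ tail x ⊎ w ≡ head x ⊎ w ≡ head y
    cover w = let z , e = tail-surj w in
      subst (λ w → w ≡ tail x ⊎ w ≡ head x ⊎ w ≡ head y) e (closed-tail (reached (connected x z)))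

  3≤deg : 3 ≤ deg
  3≤deg = large deg refl
    where
    large : ∀ D → deg ≡ D → 3 ≤ D
    large 1 D≡1 = contradiction (trans (cong spoke (sym D≡1)) spoke-deg) (σx≢x x₀)
    large 2 D≡2 = contradiction (trans (cong spoke (sym D≡2)) spoke-deg) (σσx≢x x₀)
    large (suc (suc (suc _))) _ = s≤s (s≤s (s≤s z≤n))

-- Going once round a triangle, changes from `false` to `true` alternate with changes back, so three
-- corners leave room for at most one of the former.
monochromatic-or-one : ∀ a b c → 𝟙 (not a ∧ b) + (𝟙 (not b ∧ c) + 𝟙 (not c ∧ a)) ≤ 1
monochromatic-or-one true  true  true  = z≤n
monochromatic-or-one true  true  false = ℕₚ.≤-refl
monochromatic-or-one true  false true  = ℕₚ.≤-refl
monochromatic-or-one true  false false = ℕₚ.≤-refl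
monochromatic-or-one false true  true  = ℕₚ.≤-refl
monochromatic-or-one false true  false = ℕₚ.≤-refl
monochromatic-or-one false false true  = ℕₚ.≤-refl
monochromatic-or-one false false false = z≤n

-- Brace ends and their neighbours

module Braced {n : ℕ} (P : SphereTriangulation n) (B : List (Fin n × Fin n))
              (valid : ValidBraces P B) (irreducible : Irreducible P B) (4≤n : 4 ≤ n) where
  open SphereTriangulation P
  open Map P

  Brace? : ∀ u w → Dec (Brace P B u w)
  Brace? u w = ((u , w) ∈? B) ⊎-dec ((w , u) ∈? B)
    where open DecMembership (≡-dec _≟_ _≟_) using (_∈?_)

  AdjG? : ∀ u w → Dec (AdjG P B u w)
  AdjG? u w = Adj? u w ⊎-dec Brace? u w

  Braced : Fin n → Set
  Braced u = ∃[ w ] Brace P B u w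

  braced? : ∀ u → Dec (Braced u)
  braced? u = any? (Brace? u)

  braced : Fin n → Bool
  braced u = does (braced? u)

  end₁ end₂ : Fin (length B) → Fin n
  end₁ k = proj₁ (lookup B k)
  end₂ k = proj₂ (lookup B k)

  ends-braced : ∀ k → Braced (end₁ k) × Braced (end₂ k)
  ends-braced k = (end₂ k , inj₁ (∈-lookup k)) , (end₁ k , inj₂ (∈-lookup k))

  ends-≢ : ∀ k → end₁ k ≢ end₂ k
  ends-≢ k e = ℕₚ.<⇒≢ (proj₁ (All.lookup (proj₁ valid) (∈-lookup k))) (cong toℕ e)

  ends-nonadjacent : ∀ k → ¬ Adj P (end₁ k) (end₂ k)
  ends-nonadjacent k = proj₂ (All.lookup (proj₁ valid) (∈-lookup k))

  brace-index : ∀ {u w} → Brace P B u w →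
    ∃[ k ] (end₁ k ≡ u × end₂ k ≡ w ⊎ end₁ k ≡ w × end₂ k ≡ u)
  brace-index (inj₁ p) = index p ,
    inj₁ (cong proj₁ (sym (lookup-index p)) , cong proj₂ (sym (lookup-index p)))
  brace-index (inj₂ p) = index p ,
    inj₂ (cong proj₁ (sym (lookup-index p)) , cong proj₂ (sym (lookup-index p)))

  -- As `u` is on no brace, the 3-cycle that blocks contraction has its brace between `w` and `z`.
  -- Irreducibility is a negation; a finite search turns it into a witness.
  contractible⇒brace-triangle : ∀ {u w} → ¬ Braced u → ContractibleInP P u w →
    ∃[ z ] Brace P B w z × Adj P u z
  contractible⇒brace-triangle {u} {w} u∉ contr = decide (any? λ z →
    AdjG? u z ×-dec (AdjG? w z ×-dec (Brace? u z ⊎-dec Brace? w z)))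
    where
    decide : Dec (∃[ z ] AdjG P B u z × AdjG P B w z × (Brace P B u z ⊎ Brace P B w z)) →
             ∃[ z ] Brace P B w z × Adj P u z
    decide (no none) = contradiction
      (contr , λ z u~z w~z b → none (z , u~z , w~z , b)) (irreducible u w (proj₁ contr))
    decide (yes (z , inj₂ b   , _ , _))      = contradiction (z , b) u∉
    decide (yes (z , inj₁ _   , _ , inj₁ b)) = contradiction (z , b) u∉
    decide (yes (z , inj₁ u~z , _ , inj₂ b)) = z , b , u~z

  contractible⇒braced : ∀ {u w} → ¬ Braced u → ContractibleInP P u w → Braced w
  contractible⇒braced u∉ contr = let z , b , _ = contractible⇒brace-triangle u∉ contr in z , b

  Between : Fin n → Fin (length B) → Set
  Between u k = Adj P u (end₁ k) × Adj P u (end₂ k)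

  unbraced-between : ∀ u → ¬ Braced u → ∃ (Between u)
  unbraced-between u u∉ with tail-surj u
  ... | x₀ , refl = fromIndex (brace-index b)
    where
    open Link P x₀
    open Arcs P x₀
    D≥3 : 3 ≤ deg
    D≥3 = SmallDegree.3≤deg P 4≤n x₀
    D-1 = pred deg
    -- The last edge of the link cycle serves as the chord, so that the arc from 0 to `D-1` covers
    -- the whole link.
    closing : Adj P (rim 0) (rim D-1)
    closing = Adj-sym (subst (λ x → Adj P (rim D-1) (head x)) spoke-deg (rim-step D-1))
    contr = arc-contractible D-1 0 D-1
      (ℕₚ.≤-reflexive (sym (ℕₚ.+-identityʳ D-1))) (ℕₚ.≤-pred D≥3) ℕₚ.≤-refl closing
    i = proj₁ contr
    triangle = contractible⇒brace-triangle u∉ (proj₂ (proj₂ (proj₂ contr)))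
    b = proj₁ (proj₂ triangle)
    v~z = proj₂ (proj₂ triangle)
    fromIndex : (∃[ k ] (end₁ k ≡ rim i × end₂ k ≡ proj₁ triangle ⊎
                         end₁ k ≡ proj₁ triangle × end₂ k ≡ rim i)) →
                ∃ (Between v)
    fromIndex (k , inj₁ (p , q)) = k , subst (Adj P v) (sym p) (v-rim i) , subst (Adj P v) (sym q) v~z
    fromIndex (k , inj₂ (p , q)) = k , subst (Adj P v) (sym p) v~z , subst (Adj P v) (sym q) (v-rim i)

  -- Some 3-cycle through u separates x from z, so it contains all their
  -- common neighbours.
  few-common-neighbours : ∀ u x z → ¬ Braced u → Adj P u x → Adj P u z → x ≢ z → ¬ Adj P x z →
    (∀ w → Adj P u w → Braced w → w ≡ x ⊎ w ≡ z) →
    Σ (Fin n × Fin n × Fin n) λ (a , b , c) → ∀ w → Adj P w x → Adj P w z → w ≡ a ⊎ w ≡ b ⊎ w ≡ c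
  few-common-neighbours _ _ z u∉ (x₀ , refl , refl) u~z x≢z x≁z only = result (position u~z)
    where
    open Link P x₀
    open Arcs P x₀
    Few : Fin n → Set
    Few z = Σ (Fin n × Fin n × Fin n) λ (a , b , c) →
      ∀ w → Adj P w (rim 0) → Adj P w z → w ≡ a ⊎ w ≡ b ⊎ w ≡ c

    -- `x` is `rim 0` by the choice of `x₀`. As `z` is neither `x` nor adjacent to it, `z` is
    -- `rim t` with `t ≥ 2`.
    result : ∃[ t ] t < deg × rim t ≡ z → Few z
    result (zero , _ , e)          = contradiction e x≢z
    result (suc zero , _ , refl)   = contradiction (rim-step 0) x≁z
    result (suc (suc t′) , t<D , refl) =
      [ (λ contr → contradiction contr (not-contractible 1 (s≤s z≤n) 1<t)) , viaChord ]′
        (contractible-or-chord 0 (SmallDegree.3≤deg P 4≤n x₀))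
      where
      t = suc (suc t′)
      1<t : 1 < t
      1<t = s≤s (s≤s z≤n)

      -- By `only`, no rim vertex strictly between `x` and `z` is braced, whereas a contractible
      -- edge at the unbraced `v` leads to a braced vertex.
      not-contractible : ∀ i → 0 < i → i < t → ¬ ContractibleInP P v (rim i)
      not-contractible i 0<i i<t contr =
        [ rim-≢ (ℕₚ.<-trans i<t t<D) (s≤s z≤n) (ℕₚ.>⇒≢ 0<i)
        , rim-≢ (ℕₚ.<-trans i<t t<D) t<D (ℕₚ.<⇒≢ i<t)
        ]′ (only (rim i) (v-rim i) (contractible⇒braced u∉ contr))

      viaChord : ∃[ i ] i < deg × Adj P (rim 1) (rim i) × i ≢ 0 × i ≢ 2 → Few (rim t)
      viaChord (zero , _ , _ , i≢0 , _) = contradiction refl i≢0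
      viaChord (suc zero , _ , m~i , _ , _) = contradiction m~i Adj-irrefl
      viaChord (suc (suc zero) , _ , _ , _ , i≢2) = contradiction refl i≢2
      viaChord (i@(suc (suc (suc _))) , i<D , m~i , _ , _) = decide (i ℕₚ.≤? t)
        where
        -- A chord from `rim 1` ending at or before `z` would enclose the end of a contractible
        -- edge. So it ends beyond `z` and, together with `v`, forms the separating 3-cycle.
        decide : Dec (i ≤ t) → Few (rim t)
        decide (yes i≤t) =
          let j , 1<j , j<i , contr = arc-contractible i 1 i (ℕₚ.m≤m+n i 1) (s≤s (s≤s (s≤s z≤n))) i<D m~i
          in contradiction contr (not-contractible j (ℕₚ.<⇒≤ 1<j) (ℕₚ.<-≤-trans j<i i≤t))
        decide (no i≰t) = (v , rim 1 , rim i) , covered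
          where
          t<i = ℕₚ.≰⇒> i≰t
          open Separation {1} {i} (s≤s (s≤s z≤n)) i<D m~i
          x-off : Off (rim 0)
          x-off = off-rim (s≤s z≤n) (λ ()) (λ ())
          z-off : Off (rim t)
          z-off = off-rim t<D (λ ()) (ℕₚ.<⇒≢ t<i)
          covered : ∀ w → Adj P w (rim 0) → Adj P w (rim t) → w ≡ v ⊎ w ≡ rim 1 ⊎ w ≡ rim i
          covered w w~x w~z with w ≟ v | w ≟ rim 1 | w ≟ rim i
          ... | yes p | _     | _     = inj₁ p
          ... | no _  | yes p | _     = inj₂ (inj₁ p)
          ... | no _  | no _  | yes p = inj₂ (inj₂ p)
          ... | no p  | no q  | no r  = contradiction
            (trans (sym (colour-before 0 (s≤s z≤n)))
              (trans (sym (colour-adj w~x (p , q , r) x-off))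
                (trans (colour-adj w~z (p , q , r) z-off) (colour-between t 1<t t<i))))
            (not-¬ refl)

  -- Double counting

  mixed : Fin d → ℕ
  mixed x = 𝟙 (not (braced (tail x)) ∧ braced (head x))

  -- For unbraced `u` this is the number of braced neighbours; for braced `u` it is zero.
  out : Fin n → ℕ
  out u = sum (λ x → if does (tail x ≟ u) then mixed x else 0)

  sum-out : sum out ≡ sum mixed
  sum-out = sym (+ᶠ.sum-fibres tail mixed)

  -- A triangle with two colours of vertices has exactly one such dart.
  mixed-≤ : sum mixed * 3 ≤ d
  mixed-≤ = begin
    sum mixed * 3
      ≡⟨ lemma (sum mixed) ⟩
    sum mixed + (sum mixed + sum mixed)
      -- Shifting along `φ` permutes the darts, so the three copies can be read as the three darts
      -- of the face of `x`.
      ≡⟨ cong (sum mixed +_) (cong₂ _+_ (sym (sum-φ mixed))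
           (trans (sym (sum-φ mixed)) (sym (sum-φ (mixed ∘ φ))))) ⟩
    sum mixed + (sum (mixed ∘ φ) + sum (mixed ∘ φ ∘ φ))
      ≡⟨ cong (sum mixed +_) (∑-distrib-+ (mixed ∘ φ) (mixed ∘ φ ∘ φ)) ⟨
    sum mixed + sum (λ x → mixed (φ x) + mixed (φ (φ x)))
      ≡⟨ ∑-distrib-+ mixed (λ x → mixed (φ x) + mixed (φ (φ x))) ⟨
    sum (λ x → mixed x + (mixed (φ x) + mixed (φ (φ x))))
      ≤⟨ sum-mono-≤ around ⟩
    sum {d} (λ _ → 1)
      ≡⟨ trans (sum-const d 1) (ℕₚ.*-identityʳ d) ⟩
    d ∎
    where
    open ℕₚ.≤-Reasoning
    lemma : ∀ m → m * 3 ≡ m + (m + m)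
    lemma = solve-∀
    mixed≡ : ∀ y w → tail (φ y) ≡ w → mixed y ≡ 𝟙 (not (braced (tail y)) ∧ braced w)
    mixed≡ y w e = cong (λ w → 𝟙 (not (braced (tail y)) ∧ braced w)) (trans (sym (tail-φ y)) e)
    around : ∀ x → mixed x + (mixed (φ x) + mixed (φ (φ x))) ≤ 1
    around x = ℕₚ.≤-trans
      (ℕₚ.≤-reflexive (cong₂ _+_ (mixed≡ x _ refl)
        (cong₂ _+_ (mixed≡ (φ x) _ refl) (mixed≡ (φ (φ x)) (tail x) (cong tail (face-3 x))))))
      (monochromatic-or-one (braced (tail x)) (braced (tail (φ x))) (braced (tail (φ (φ x)))))

  out-≥ : ∀ {m u} → ¬ Braced u → (w : Fin m → Fin n) → (∀ i j → w i ≡ w j → i ≡ j) →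
          (∀ i → Adj P u (w i)) → (∀ i → Braced (w i)) → m ≤ out u
  out-≥ {m} {u} u∉ w w-inj u~w w∈ = sum-≥ _ y (λ i j e → w-inj i j
      (trans (sym (head-y i)) (trans (cong (head) e) (head-y j))))
    (λ i → ℕₚ.≤-reflexive (sym (counted i)))
    where
    y : Fin m → Fin d
    y i = proj₁ (u~w i)
    tail-y : ∀ i → tail (y i) ≡ u
    tail-y i = proj₁ (proj₂ (u~w i))
    head-y : ∀ i → head (y i) ≡ w i
    head-y i = proj₂ (proj₂ (u~w i))
    counted : ∀ i → (if does (tail (y i) ≟ u) then mixed (y i) else 0) ≡ 1
    counted i = trans (cong (λ b → if b then mixed (y i) else 0) (dec-true (tail (y i) ≟ u) (tail-y i)))
      (cong 𝟙 (cong₂ _∧_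
        (cong not (dec-false (braced? _) (subst (¬_ ∘ Braced) (sym (tail-y i)) u∉)))
        (dec-true (braced? _) (subst Braced (sym (head-y i)) (w∈ i)))))

  -- The ends of brace `k` are then the only braced neighbours of `u`, which is what
  -- `few-common-neighbours` requires.
  Poor : Fin n → Fin (length B) → Set
  Poor u k = ¬ Braced u × ¬ (3 ≤ out u) × Between u k

  poor? : ∀ u k → Dec (Poor u k)
  poor? u k = ¬? (braced? u) ×-dec (¬? (3 ℕₚ.≤? out u) ×-dec (Adj? u (end₁ k) ×-dec Adj? u (end₂ k)))

  poor : Fin n → Fin (length B) → ℕ
  poor u k = 𝟙 (does (poor? u k))

  poor-few : ∀ k → sum (λ u → poor u k) ≤ 3
  poor-few k = decide (any? (λ u → poor? u k))
    where
    x = end₁ k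
    z = end₂ k
    decide : Dec (∃[ u ] Poor u k) → sum (λ u → poor u k) ≤ 3
    decide (no none) = ℕₚ.≤-trans (ℕₚ.≤-reflexive (+ᶠ.sum-zero (λ u → poor u k)
      (λ u → cong 𝟙 (dec-false (poor? u k) (λ p → none (u , p)))))) z≤n
    -- One poor vertex suffices: the 3-cycle found through it contains all common neighbours of the
    -- two ends, in particular every vertex poor for `k`.
    decide (yes (u , u∉ , ¬3≤out , u~x , u~z)) =
      let (a , b , c) , cover = few-common-neighbours u x z u∉ u~x u~z (ends-≢ k) (ends-nonadjacent k) only
      in sum-cover₃ (λ w → does (poor? w k)) a b c (λ w e →
           let _ , _ , w~x , w~z = holds (poor? w k) e in cover w w~x w~z)
      where
      holds : ∀ {A : Set} (a? : Dec A) → does a? ≡ true → A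
      holds (yes a) _ = a
      only : ∀ w → Adj P u w → Braced w → w ≡ x ⊎ w ≡ z
      only w u~w w∈ with w ≟ x | w ≟ z
      ... | yes p | _     = inj₁ p
      ... | no  _ | yes q = inj₂ q
      ... | no  p | no  q = contradiction (out-≥ u∉ nbr nbr-inj u~nbr nbr∈) ¬3≤out
        where
        nbr : Fin 3 → Fin n
        nbr zero             = w
        nbr (suc zero)       = x
        nbr (suc (suc zero)) = z
        nbr-inj : ∀ i j → nbr i ≡ nbr j → i ≡ j
        nbr-inj zero             zero             _ = refl
        nbr-inj zero             (suc zero)       e = contradiction e p
        nbr-inj zero             (suc (suc zero)) e = contradiction e q
        nbr-inj (suc zero)       zero             e = contradiction (sym e) p
        nbr-inj (suc zero)       (suc zero)       _ = refl
        nbr-inj (suc zero)       (suc (suc zero)) e = contradiction e (ends-≢ k)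
        nbr-inj (suc (suc zero)) zero             e = contradiction (sym e) q
        nbr-inj (suc (suc zero)) (suc zero)       e = contradiction (sym e) (ends-≢ k)
        nbr-inj (suc (suc zero)) (suc (suc zero)) _ = refl
        u~nbr : ∀ i → Adj P u (nbr i)
        u~nbr zero             = u~w
        u~nbr (suc zero)       = u~x
        u~nbr (suc (suc zero)) = u~z
        nbr∈ : ∀ i → Braced (nbr i)
        nbr∈ zero             = w∈
        nbr∈ (suc zero)       = proj₁ (ends-braced k)
        nbr∈ (suc (suc zero)) = proj₂ (ends-braced k)

  2≤out : ∀ {u} k → ¬ Braced u → Between u k → 2 ≤ out u
  2≤out {u} k u∉ (u~x , u~z) = out-≥ u∉ nbr nbr-inj u~nbr nbr∈
    where
    nbr : Fin 2 → Fin n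
    nbr zero       = end₁ k
    nbr (suc zero) = end₂ k
    nbr-inj : ∀ i j → nbr i ≡ nbr j → i ≡ j
    nbr-inj zero       zero       _ = refl
    nbr-inj zero       (suc zero) e = contradiction e (ends-≢ k)
    nbr-inj (suc zero) zero       e = contradiction (sym e) (ends-≢ k)
    nbr-inj (suc zero) (suc zero) _ = refl
    u~nbr : ∀ i → Adj P u (nbr i)
    u~nbr zero       = u~x
    u~nbr (suc zero) = u~z
    nbr∈ : ∀ i → Braced (nbr i)
    nbr∈ zero       = proj₁ (ends-braced k)
    nbr∈ (suc zero) = proj₂ (ends-braced k)

  -- A vertex with three braced neighbours is paid for by `out`, a braced one by the constant 3. Any
  -- other lies between the ends of a brace: it gets 2 from these ends and 1 for being poor.
  charge : ∀ u → 3 ≤ out u + (𝟙 (braced u) * 3 + sum (poor u))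
  charge u = decide (braced? u) (3 ℕₚ.≤? out u)
    where
    decide : Dec (Braced u) → Dec (3 ≤ out u) → 3 ≤ out u + (𝟙 (braced u) * 3 + sum (poor u))
    decide _ (yes 3≤out) = ℕₚ.≤-trans 3≤out (ℕₚ.m≤m+n _ _)
    decide (yes u∈) (no _) = begin
      3                                              ≡⟨ cong (λ b → 𝟙 b * 3) (dec-true (braced? u) u∈) ⟨
      𝟙 (braced u) * 3                               ≤⟨ ℕₚ.m≤m+n _ (sum (poor u)) ⟩
      𝟙 (braced u) * 3 + sum (poor u)                ≤⟨ ℕₚ.m≤n+m _ (out u) ⟩
      out u + (𝟙 (braced u) * 3 + sum (poor u))      ∎
      where open ℕₚ.≤-Reasoning
    decide (no u∉) (no ¬3≤out) =
      let k , u-k = unbraced-between u u∉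
      in ℕₚ.+-mono-≤ (2≤out k u∉ u-k) (begin
        1                                            ≡⟨ cong 𝟙 (dec-true (poor? u k) (u∉ , ¬3≤out , u-k)) ⟨
        poor u k                                     ≤⟨ term≤sum (poor u) k ⟩
        sum (poor u)                                 ≤⟨ ℕₚ.m≤n+m _ (𝟙 (braced u) * 3) ⟩
        𝟙 (braced u) * 3 + sum (poor u)              ∎)
      where open ℕₚ.≤-Reasoning

  braced-≤ : sum (𝟙 ∘ braced) ≤ length B * 2
  braced-≤ = begin
    sum (𝟙 ∘ braced)
      ≤⟨ sum-mono-≤ isEnd ⟩
    sum (λ u → sum (λ k → at (end₁ k) u + at (end₂ k) u))
      ≡⟨ ∑-comm (λ u k → at (end₁ k) u + at (end₂ k) u) ⟩
    sum (λ k → sum (λ u → at (end₁ k) u + at (end₂ k) u))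
      ≡⟨ sum-cong-≗ (λ k → trans (∑-distrib-+ (at (end₁ k)) (at (end₂ k)))
           (cong₂ _+_ (sum-𝟙 (end₁ k)) (sum-𝟙 (end₂ k)))) ⟩
    sum {length B} (λ _ → 2)
      ≡⟨ sum-const (length B) 2 ⟩
    length B * 2 ∎
    where
    open ℕₚ.≤-Reasoning
    at : Fin n → Fin n → ℕ
    at a u = 𝟙 (does (u ≟ a))
    at-self : ∀ {a u} → a ≡ u → 1 ≤ at a u
    at-self {a} refl = ℕₚ.≤-reflexive (sym (cong 𝟙 (dec-true (a ≟ a) refl)))
    isEnd : ∀ u → 𝟙 (braced u) ≤ sum (λ k → at (end₁ k) u + at (end₂ k) u)
    isEnd u with braced? u
    ... | no _        = z≤n
    ... | yes (w , b) = fromIndex (brace-index b)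
      where
      fromIndex : (∃[ k ] (end₁ k ≡ u × end₂ k ≡ w ⊎ end₁ k ≡ w × end₂ k ≡ u)) →
                  1 ≤ sum (λ k → at (end₁ k) u + at (end₂ k) u)
      fromIndex (k , inj₁ (p , _)) = ℕₚ.≤-trans (ℕₚ.≤-trans (at-self p) (ℕₚ.m≤m+n _ _))
        (term≤sum (λ k → at (end₁ k) u + at (end₂ k) u) k)
      fromIndex (k , inj₂ (_ , q)) = ℕₚ.≤-trans (ℕₚ.≤-trans (at-self q) (ℕₚ.m≤n+m _ (at (end₁ k) u)))
        (term≤sum (λ k → at (end₁ k) u + at (end₂ k) u) k)

  poor-≤ : sum (λ u → sum (poor u)) ≤ length B * 3
  poor-≤ = begin
    sum (λ u → sum (poor u))           ≡⟨ ∑-comm poor ⟩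
    sum (λ k → sum (λ u → poor u k))   ≤⟨ sum-mono-≤ poor-few ⟩
    sum {length B} (λ _ → 3)           ≡⟨ sum-const (length B) 3 ⟩
    length B * 3                       ∎
    where open ℕₚ.≤-Reasoning

  -- This is `charge` summed over all vertices: three for each of at most `2b` braced vertices, and
  -- three per brace for the poor ones.
  3n≤ : n * 3 ≤ sum mixed + (length B * 2 * 3 + length B * 3)
  3n≤ = begin
    n * 3
      ≡⟨ sum-const n 3 ⟨
    sum {n} (λ _ → 3)
      ≤⟨ sum-mono-≤ charge ⟩
    sum (λ u → out u + (𝟙 (braced u) * 3 + sum (poor u)))
      ≡⟨ ∑-distrib-+ out (λ u → 𝟙 (braced u) * 3 + sum (poor u)) ⟩
    sum out + sum (λ u → 𝟙 (braced u) * 3 + sum (poor u))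
      ≡⟨ cong₂ _+_ sum-out (∑-distrib-+ (λ u → 𝟙 (braced u) * 3) (λ u → sum (poor u))) ⟩
    sum mixed + (sum (λ u → 𝟙 (braced u) * 3) + sum (λ u → sum (poor u)))
      ≡⟨ cong (λ m → sum mixed + (m + sum (λ u → sum (poor u)))) (*-distribʳ-sum 3 (𝟙 ∘ braced)) ⟨
    sum mixed + (sum (𝟙 ∘ braced) * 3 + sum (λ u → sum (poor u)))
      ≤⟨ ℕₚ.+-monoʳ-≤ (sum mixed) (ℕₚ.+-mono-≤ (ℕₚ.*-monoˡ-≤ 3 braced-≤) poor-≤) ⟩
    sum mixed + (length B * 2 * 3 + length B * 3) ∎
    where open ℕₚ.≤-Reasoning

  n+4≤9b : n + 4 ≤ 9 * length B
  -- Tripling `3n≤` and inserting `mixed-≤` and `d + 12 = 6n` gives `9n + 12 ≤ 27b + 6n`; carrying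
  -- `6 * n` on both sides avoids subtraction.
  n+4≤9b = ℕₚ.*-cancelʳ-≤ (n + 4) (9 * length B) 3 (ℕₚ.+-cancelʳ-≤ (6 * n) _ _ (begin
    (n + 4) * 3 + 6 * n                                   ≡⟨ lemma₁ n ⟩
    n * 3 * 3 + 12                                        ≤⟨ ℕₚ.+-monoˡ-≤ 12 (ℕₚ.*-monoˡ-≤ 3 3n≤) ⟩
    (sum mixed + (b * 2 * 3 + b * 3)) * 3 + 12            ≡⟨ lemma₂ (sum mixed) b ⟩
    9 * b * 3 + (sum mixed * 3 + 12)                      ≤⟨ ℕₚ.+-monoʳ-≤ (9 * b * 3) (ℕₚ.+-monoˡ-≤ 12 mixed-≤) ⟩
    9 * b * 3 + (d + 12)                                  ≡⟨ cong (9 * b * 3 +_) euler ⟩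
    9 * b * 3 + 6 * n                                     ∎))
    where
    open ℕₚ.≤-Reasoning
    b = length B
    lemma₁ : ∀ n → (n + 4) * 3 + 6 * n ≡ n * 3 * 3 + 12
    lemma₁ = solve-∀
    lemma₂ : ∀ m b → (m + (b * 2 * 3 + b * 3)) * 3 + 12 ≡ 9 * b * 3 + (m * 3 + 12)
    lemma₂ = solve-∀

theorem2p7 : ∀ {n : ℕ} (P : SphereTriangulation n) (B : List (Fin n × Fin n))
    → ValidBraces P B → Irreducible P B → 1 ≤ length B
    → n + 4 ≤ 11 * length B
theorem2p7 {n} P B valid irreducible 1≤b = decide (4 ℕₚ.≤? n)
  where
  decide : Dec (4 ≤ n) → n + 4 ≤ 11 * length B
  decide (yes 4≤n) = ℕₚ.≤-trans (Braced.n+4≤9b P B valid irreducible 4≤n)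
    (ℕₚ.*-monoˡ-≤ (length B) (ℕₚ.m≤m+n 9 2))
  -- Degree at least three relies on `4 ≤ n`. For smaller `n`, already `n + 4 ≤ 7 ≤ 11 ≤ 11b`.
  decide (no 4≰n) = ℕₚ.≤-trans
    (ℕₚ.+-monoˡ-≤ 4 (ℕₚ.≤-pred (ℕₚ.≰⇒> 4≰n)))
    (ℕₚ.≤-trans (ℕₚ.m≤m+n 7 4) (ℕₚ.*-monoʳ-≤ 11 1≤b))
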